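{- For any $a\in\mathbb{N}$ and $b,c\in\mathbb{N}_0$, $$t^{\star}(\{2\}^{a},1,\{2\}^{b},3,\{2\}^{c})=-\frac{4}{\pi}t(\overline{2a+2b+2c+5})-\frac{8}{\pi}t(2a+1,\overline{2b+2c+4})-\frac{8}{\pi}t(\overline{2a+2b+3},2c+2)-\frac{16}{\pi}t(2a+1,\overline{2b+2},2c+2)$$ and $$t^{\star}(\{2\}^{a},1,\{2\}^{b},1,\{2\}^{c})=-\frac{4}{\pi}t(\overline{2a+2b+2c+3})-\frac{8}{\pi}t(2a+1,\overline{2b+2c+2})-\frac{8}{\pi}t(2a+2b+2,\overline{2c+1})-\frac{16}{\pi}t(2a+1,2b+1,\overline{2c+1}).$$
   Context: $t^{\star}(\boldsymbol{s})=\sum_{k_1\geq\cdots\geq k_r\geq1}\prod_{j}(2k_j-1)^{ -s_j}$ for an index with $s_1>1$; $\{2\}^a$ is $2$ repeated $a$ times. Alternating multiple $t$-values: $t(\boldsymbol{s};\boldsymbol{\sigma})=\sum_{k_1>\cdots>k_r\geq1}\prod_{j}\frac{\sigma_j^{k_j}}{(2k_j-1)^{s_j}}$, where a bar over $s_j$ means $\sigma_j=-1$ and no bar means $\sigma_j=1$. -}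

module Defs where

open import Algebra.Bundles using (CommutativeRing)
open import Data.Integer.Base as ℤ using (+_)
import Data.Integer.Properties as ℤ
open import Data.List.Base using (List; []; _∷_; _++_; map; replicate; length)
open import Data.List.Relation.Unary.All using (All; []; _∷_)
open import Data.List.Relation.Unary.All.Properties using (++⁺; replicate⁺)
open import Data.Nat.Base as ℕ using (ℕ; zero; suc; z≤n; s≤s)
import Data.Nat.Properties as ℕ
open import Data.Product.Base using (∃; _×_; _,_; proj₁; proj₂)
open import Data.Rational.Base hiding (_≃_)
open import Data.Rational.Properties
open import Data.Rational.Solver using (module +-*-Solver)
open import Data.Rational.Unnormalised.Base as ℚᵘ using (mkℚᵘ)
import Data.Rational.Unnormalised.Properties as ℚᵘ
open import Data.Sign.Base as Sign using (Sign)
open import Data.Sum.Base using (inj₁; inj₂)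
open import Relation.Binary.PropositionalEquality
open import Relation.Nullary using (yes; no; contradiction)
open import Algebra.Properties.Semiring.Exp (CommutativeRing.semiring +-*-commutativeRing) using (_^_)

open +-*-Solver using (solve; con; _:+_; _:*_; _:-_; :-_; _:=_)

*-mono-nonNeg : ∀ {p q r} → 0ℚ ≤ r → p ≤ q → r * p ≤ r * q
*-mono-nonNeg {r = r} 0≤r p≤q = *-monoˡ-≤-nonNeg r {{nonNegative 0≤r}} p≤q

*-mono₂ : ∀ {p q r s} → 0ℚ ≤ p → 0ℚ ≤ s → p ≤ q → r ≤ s → p * r ≤ q * s
*-mono₂ {p} {q} {r} {s} 0≤p 0≤s p≤q r≤s =
  ≤-trans (*-mono-nonNeg 0≤p r≤s) (*-monoʳ-≤-nonNeg s {{nonNegative 0≤s}} p≤q)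

0≤* : ∀ {p q} → 0ℚ ≤ p → 0ℚ ≤ q → 0ℚ ≤ p * q
0≤* {p} {q} 0≤p 0≤q = subst (_≤ p * q) (*-zeroʳ p) (*-mono-nonNeg 0≤p 0≤q)

0<* : ∀ {p q} → 0ℚ < p → 0ℚ < q → 0ℚ < p * q
0<* {p} {q} 0<p 0<q =
  subst (_< p * q) (*-zeroʳ p) (*-monoʳ-<-pos p {{positive 0<p}} 0<q)

0≤+ : ∀ {p q} → 0ℚ ≤ p → 0ℚ ≤ q → 0ℚ ≤ p + q
0≤+ {p} {q} 0≤p 0≤q = subst (_≤ p + q) (+-identityˡ 0ℚ) (+-mono-≤ 0≤p 0≤q)

p≤p+q : ∀ {p q} → 0ℚ ≤ q → p ≤ p + q
p≤p+q {p} {q} 0≤q = subst (_≤ p + q) (+-identityʳ p) (+-monoʳ-≤ p 0≤q)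

≤⇒0≤- : ∀ {p q} → p ≤ q → 0ℚ ≤ q - p
≤⇒0≤- {p} {q} p≤q = subst (_≤ q - p) (+-inverseʳ p) (+-monoˡ-≤ (- p) p≤q)

0≤-⇒≤ : ∀ {p q} → 0ℚ ≤ q - p → p ≤ q
0≤-⇒≤ {p} {q} h = subst (p ≤_) (solve 2 (λ p q → p :+ (q :- p) := q) refl p q) (p≤p+q h)

-‿mono : ∀ {p q} → 0ℚ ≤ q → p - q ≤ p
-‿mono {p} {q} h = subst (p - q ≤_) (+-identityʳ p) (+-monoʳ-≤ p (neg-antimono-≤ h))

∣p-q∣≡∣q-p∣ : ∀ p q → ∣ p - q ∣ ≡ ∣ q - p ∣
∣p-q∣≡∣q-p∣ p q =
  trans (sym (∣-p∣≡∣p∣ (p - q))) (cong ∣_∣ (solve 2 (λ p q → :- (p :- q) := q :- p) refl p q))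

∣∣-triangle : ∀ p q r → ∣ p - r ∣ ≤ ∣ p - q ∣ + ∣ q - r ∣
∣∣-triangle p q r = subst (λ x → ∣ x ∣ ≤ ∣ p - q ∣ + ∣ q - r ∣)
  (solve 3 (λ p q r → (p :- q) :+ (q :- r) := p :- r) refl p q r)
  (∣p+q∣≤∣p∣+∣q∣ (p - q) (q - r))

recip : (p : ℚ) → 0ℚ < p → ℚ
recip p 0<p = (1/ p) {{>-nonZero 0<p}}

*-recip : ∀ p (0<p : 0ℚ < p) → p * recip p 0<p ≡ 1ℚ
*-recip p 0<p = *-inverseʳ p {{>-nonZero 0<p}}

0<recip : ∀ p (0<p : 0ℚ < p) → 0ℚ < recip p 0<p
0<recip p 0<p = positive⁻¹ _ {{1/pos⇒pos p {{positive 0<p}}}}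

recip-antimono : ∀ {p q} (0<p : 0ℚ < p) (0<q : 0ℚ < q) → p ≤ q → recip q 0<q ≤ recip p 0<p
recip-antimono {p} {q} 0<p 0<q p≤q = *-cancelˡ-≤-pos p {{positive 0<p}}
  (≤-trans (*-monoʳ-≤-nonNeg q⁻¹ {{nonNegative (<⇒≤ (0<recip q 0<q))}} p≤q)
           (≤-reflexive (trans (*-recip q 0<q) (sym (*-recip p 0<p)))))
  where q⁻¹ = recip q 0<q

Cauchy : (ℕ → ℚ) → Set
Cauchy x = ∀ ε → 0ℚ < ε → ∃ λ N → ∀ m n → N ℕ.≤ m → N ℕ.≤ n → ∣ x m - x n ∣ < ε

-- No quotient is taken: equality of reals is the relation _≃_ below.
record ℝ : Set where
  constructor mkℝ
  field
    seq    : ℕ → ℚ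
    cauchy : Cauchy seq
open ℝ public

infix 4 _≃_

_≃_ : ℝ → ℝ → Set
x ≃ y = ∀ ε → 0ℚ < ε → ∃ λ N → ∀ n → N ℕ.≤ n → ∣ seq x n - seq y n ∣ < ε

Cauchy≤ : ℚ → (ℕ → ℚ) → Set
Cauchy≤ C x = ∀ ε → 0ℚ < ε → ∃ λ N → ∀ m n → N ℕ.≤ m → N ℕ.≤ n → ∣ x m - x n ∣ ≤ C * ε

rescale : ∀ x C → 0ℚ ≤ C → Cauchy≤ C x → Cauchy x
rescale x C 0≤C h ε 0<ε = proj₁ r , λ m n p q → ≤-<-trans (proj₂ r m n p q) Cδ<ε
  where
  0<1+C : 0ℚ < 1ℚ + C
  0<1+C = <-≤-trans (positive⁻¹ 1ℚ) (p≤p+q 0≤C)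
  δ = ε * recip (1ℚ + C) 0<1+C
  0<δ : 0ℚ < δ
  0<δ = 0<* 0<ε (0<recip _ 0<1+C)
  r = h δ 0<δ
  Cδ<ε : C * δ < ε
  Cδ<ε = begin-strict
    C * δ                    ≡⟨ +-identityˡ _ ⟨
    0ℚ + C * δ               <⟨ +-monoˡ-< (C * δ) 0<δ ⟩
    δ + C * δ                ≡⟨ solve 3 (λ e c i → e :* i :+ c :* (e :* i) := e :* ((con 1ℚ :+ c) :* i)) refl ε C (recip (1ℚ + C) 0<1+C) ⟩
    ε * ((1ℚ + C) * recip (1ℚ + C) 0<1+C) ≡⟨ cong (ε *_) (*-recip _ 0<1+C) ⟩
    ε * 1ℚ                   ≡⟨ *-identityʳ ε ⟩
    ε                        ∎
    where open ≤-Reasoning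

symmetrise : ∀ x → (∀ ε → 0ℚ < ε → ∃ λ N → ∀ m n → N ℕ.≤ n → n ℕ.≤ m → ∣ x m - x n ∣ < ε) → Cauchy x
symmetrise x h ε 0<ε = N , f
  where
  N = proj₁ (h ε 0<ε)
  f : ∀ m n → N ℕ.≤ m → N ℕ.≤ n → ∣ x m - x n ∣ < ε
  f m n p q with ℕ.≤-total n m
  ... | inj₁ n≤m = proj₂ (h ε 0<ε) m n q n≤m
  ... | inj₂ m≤n = subst (_< ε) (∣p-q∣≡∣q-p∣ (x n) (x m)) (proj₂ (h ε 0<ε) n m p m≤n)

both : ∀ {M N k} → M ℕ.⊔ N ℕ.≤ k → M ℕ.≤ k × N ℕ.≤ k
both {M} {N} h = ℕ.m⊔n≤o⇒m≤o M N h , ℕ.m⊔n≤o⇒n≤o M N h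

real : ℚ → ℝ
real q = mkℝ (λ _ → q) λ ε 0<ε → 0 , λ _ _ _ _ → subst (λ x → ∣ x ∣ < ε) (sym (+-inverseʳ q)) 0<ε

infixl 6 _+ᵣ_ _-ᵣ_
infixl 7 _*ᵣ_
infix  8 -ᵣ_

_+ᵣ_ : ℝ → ℝ → ℝ
x +ᵣ y = mkℝ (λ n → seq x n + seq y n) (rescale (λ n → seq x n + seq y n) (+ 2 / 1) (*≤* (ℤ.+≤+ z≤n)) bound)
  where
  bound : Cauchy≤ (+ 2 / 1) (λ n → seq x n + seq y n)
  bound ε 0<ε = proj₁ X ℕ.⊔ proj₁ Y , λ m n p q →
    let p₁ , p₂ = both {proj₁ X} p ; q₁ , q₂ = both {proj₁ X} q in begin
    ∣ (seq x m + seq y m) - (seq x n + seq y n) ∣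
      ≡⟨ cong ∣_∣ (solve 4 (λ a b c d → (a :+ b) :- (c :+ d) := (a :- c) :+ (b :- d)) refl
                    (seq x m) (seq y m) (seq x n) (seq y n)) ⟩
    ∣ (seq x m - seq x n) + (seq y m - seq y n) ∣
      ≤⟨ ∣p+q∣≤∣p∣+∣q∣ (seq x m - seq x n) (seq y m - seq y n) ⟩
    ∣ seq x m - seq x n ∣ + ∣ seq y m - seq y n ∣
      ≤⟨ +-mono-≤ (<⇒≤ (proj₂ X m n p₁ q₁)) (<⇒≤ (proj₂ Y m n p₂ q₂)) ⟩
    ε + ε
      ≡⟨ solve 1 (λ e → e :+ e := con (+ 2 / 1) :* e) refl ε ⟩
    (+ 2 / 1) * ε ∎
    where
    open ≤-Reasoning
    X = cauchy x ε 0<ε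
    Y = cauchy y ε 0<ε

-ᵣ_ : ℝ → ℝ
-ᵣ x = mkℝ (λ n → - seq x n) λ ε 0<ε →
  let N , h = cauchy x ε 0<ε in N , λ m n p q →
  subst (_< ε)
    (trans (sym (∣-p∣≡∣p∣ (seq x m - seq x n)))
           (cong ∣_∣ (solve 2 (λ a b → :- (a :- b) := (:- a) :- (:- b)) refl (seq x m) (seq x n))))
    (h m n p q)

_-ᵣ_ : ℝ → ℝ → ℝ
x -ᵣ y = x +ᵣ (-ᵣ y)

eventual-bound : ∀ x → ∃ λ K → 0ℚ ≤ K × ∃ λ N → ∀ n → N ℕ.≤ n → ∣ seq x n ∣ ≤ K
eventual-bound x = 1ℚ + ∣ seq x N ∣ , 0≤+ {1ℚ} (*≤* (ℤ.+≤+ z≤n)) (0≤∣p∣ (seq x N)) , N , bound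
  where
  open ≤-Reasoning
  N = proj₁ (cauchy x 1ℚ (positive⁻¹ 1ℚ))
  bound : ∀ n → N ℕ.≤ n → ∣ seq x n ∣ ≤ 1ℚ + ∣ seq x N ∣
  bound n p = begin
    ∣ seq x n ∣
      ≡⟨ cong ∣_∣ (solve 2 (λ a b → a := (a :- b) :+ b) refl (seq x n) (seq x N)) ⟩
    ∣ (seq x n - seq x N) + seq x N ∣
      ≤⟨ ∣p+q∣≤∣p∣+∣q∣ (seq x n - seq x N) (seq x N) ⟩
    ∣ seq x n - seq x N ∣ + ∣ seq x N ∣
      ≤⟨ +-monoˡ-≤ ∣ seq x N ∣ (<⇒≤ (proj₂ (cauchy x 1ℚ (positive⁻¹ 1ℚ)) n N p ℕ.≤-refl)) ⟩
    1ℚ + ∣ seq x N ∣ ∎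

_*ᵣ_ : ℝ → ℝ → ℝ
x *ᵣ y = mkℝ (λ n → seq x n * seq y n) (rescale (λ n → seq x n * seq y n) (K + L) (0≤+ 0≤K 0≤L) bound)
  where
  open ≤-Reasoning
  K   = proj₁ (eventual-bound x)
  0≤K = proj₁ (proj₂ (eventual-bound x))
  M   = proj₁ (proj₂ (proj₂ (eventual-bound x)))
  ∣x∣≤K = proj₂ (proj₂ (proj₂ (eventual-bound x)))
  L   = proj₁ (eventual-bound y)
  0≤L = proj₁ (proj₂ (eventual-bound y))
  N   = proj₁ (proj₂ (proj₂ (eventual-bound y)))
  ∣y∣≤L = proj₂ (proj₂ (proj₂ (eventual-bound y)))
  bound : Cauchy≤ (K + L) (λ n → seq x n * seq y n)
  bound ε 0<ε = (proj₁ X ℕ.⊔ proj₁ Y) ℕ.⊔ (M ℕ.⊔ N) , λ m n p q →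
    let p₁ , p₂ = both {proj₁ X ℕ.⊔ proj₁ Y} p
        q₁ , q₂ = both {proj₁ X ℕ.⊔ proj₁ Y} q
        pX , pY = both {proj₁ X} p₁
        qX , qY = both {proj₁ X} q₁
        pM , _  = both {M} p₂
        _  , qN = both {M} q₂
        dx = seq x m - seq x n
        dy = seq y m - seq y n
    in begin
    ∣ seq x m * seq y m - seq x n * seq y n ∣
      ≡⟨ cong ∣_∣ (solve 4 (λ a b c d → a :* b :- c :* d := a :* (b :- d) :+ d :* (a :- c)) refl
                    (seq x m) (seq y m) (seq x n) (seq y n)) ⟩
    ∣ seq x m * dy + seq y n * dx ∣
      ≤⟨ ∣p+q∣≤∣p∣+∣q∣ (seq x m * dy) (seq y n * dx) ⟩
    ∣ seq x m * dy ∣ + ∣ seq y n * dx ∣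
      ≡⟨ cong₂ _+_ (∣p*q∣≡∣p∣*∣q∣ (seq x m) dy) (∣p*q∣≡∣p∣*∣q∣ (seq y n) dx) ⟩
    ∣ seq x m ∣ * ∣ dy ∣ + ∣ seq y n ∣ * ∣ dx ∣
      ≤⟨ +-mono-≤
           (*-mono₂ (0≤∣p∣ (seq x m)) (<⇒≤ 0<ε) (∣x∣≤K m pM) (<⇒≤ (proj₂ Y m n pY qY)))
           (*-mono₂ (0≤∣p∣ (seq y n)) (<⇒≤ 0<ε) (∣y∣≤L n qN) (<⇒≤ (proj₂ X m n pX qX))) ⟩
    K * ε + L * ε
      ≡⟨ *-distribʳ-+ ε K L ⟨
    (K + L) * ε ∎
    where
    X = cauchy x ε 0<ε
    Y = cauchy y ε 0<ε

Positiveᵣ : ℝ → Set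
Positiveᵣ x = ∃ λ δ → 0ℚ < δ × ∃ λ N → ∀ n → N ℕ.≤ n → δ ≤ seq x n

-- The reciprocal drops the initial segment of the sequence on which the
-- entries need not be invertible.
inv : (x : ℝ) → Positiveᵣ x → ℝ
inv x (δ , 0<δ , N , δ≤x) = mkℝ y (rescale y (δ⁻¹ * δ⁻¹) (0≤* 0≤δ⁻¹ 0≤δ⁻¹) bound)
  where
  open ≤-Reasoning
  δ⁻¹ = recip δ 0<δ
  0≤δ⁻¹ = <⇒≤ (0<recip δ 0<δ)
  z : ℕ → ℚ
  z n = seq x (N ℕ.+ n)
  δ≤z : ∀ n → δ ≤ z n
  δ≤z n = δ≤x (N ℕ.+ n) (ℕ.m≤m+n N n)
  0<z : ∀ n → 0ℚ < z n
  0<z n = <-≤-trans 0<δ (δ≤z n)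
  y : ℕ → ℚ
  y n = recip (z n) (0<z n)
  0≤y : ∀ n → 0ℚ ≤ y n
  0≤y n = <⇒≤ (0<recip (z n) (0<z n))
  y≤δ⁻¹ : ∀ n → y n ≤ δ⁻¹
  y≤δ⁻¹ n = recip-antimono 0<δ (0<z n) (δ≤z n)
  diff : ∀ m n → y m - y n ≡ (y m * y n) * (z n - z m)
  diff m n = begin-equality
    y m - y n                              ≡⟨ cong₂ _-_ (*-identityʳ (y m)) (*-identityʳ (y n)) ⟨
    y m * 1ℚ - y n * 1ℚ                    ≡⟨ cong₂ (λ a b → y m * a - y n * b) (*-recip (z n) (0<z n)) (*-recip (z m) (0<z m)) ⟨
    y m * (z n * y n) - y n * (z m * y m)  ≡⟨ solve 4 (λ a b c d → a :* (d :* b) :- b :* (c :* a) := (a :* b) :* (d :- c)) refl (y m) (y n) (z m) (z n) ⟩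
    (y m * y n) * (z n - z m)              ∎
  bound : Cauchy≤ (δ⁻¹ * δ⁻¹) y
  bound ε 0<ε = proj₁ X , λ m n p q → begin
    ∣ y m - y n ∣
      ≡⟨ cong ∣_∣ (diff m n) ⟩
    ∣ (y m * y n) * (z n - z m) ∣
      ≡⟨ ∣p*q∣≡∣p∣*∣q∣ (y m * y n) (z n - z m) ⟩
    ∣ y m * y n ∣ * ∣ z n - z m ∣
      ≡⟨ cong (_* ∣ z n - z m ∣) (0≤p⇒∣p∣≡p (0≤* (0≤y m) (0≤y n))) ⟩
    (y m * y n) * ∣ z n - z m ∣
      ≤⟨ *-mono₂ (0≤* (0≤y m) (0≤y n)) (<⇒≤ 0<ε)
           (*-mono₂ (0≤y m) 0≤δ⁻¹ (y≤δ⁻¹ m) (y≤δ⁻¹ n))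
           (<⇒≤ (proj₂ X (N ℕ.+ n) (N ℕ.+ m) (ℕ.≤-trans q (ℕ.m≤n+m n N)) (ℕ.≤-trans p (ℕ.m≤n+m m N)))) ⟩
    (δ⁻¹ * δ⁻¹) * ε ∎
    where X = cauchy x ε 0<ε

-- odd⁻¹ n = 1/(2n+1), that is 1/(2k-1) for k = n+1.
odd⁻¹ : ℕ → ℚ
odd⁻¹ n = + 1 / suc (2 ℕ.* n)

odd : ℕ → ℚ
odd n = + suc (2 ℕ.* n) / 1

odd⁻¹*odd : ∀ n → odd⁻¹ n * odd n ≡ 1ℚ
odd⁻¹*odd n = toℚᵘ-injective (begin-equality
  toℚᵘ (odd⁻¹ n * odd n)                  ≃⟨ toℚᵘ-homo-* (odd⁻¹ n) (odd n) ⟩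
  toℚᵘ (odd⁻¹ n) ℚᵘ.* toℚᵘ (odd n)        ≃⟨ ℚᵘ.*-cong (toℚᵘ-fromℚᵘ (mkℚᵘ (+ 1) (2 ℕ.* n))) (toℚᵘ-fromℚᵘ (mkℚᵘ (+ suc (2 ℕ.* n)) 0)) ⟩
  mkℚᵘ (+ 1) (2 ℕ.* n) ℚᵘ.* mkℚᵘ (+ suc (2 ℕ.* n)) 0  ≃⟨ ℚᵘ.*≡* (cong +_ (cong suc eq)) ⟩
  toℚᵘ 1ℚ ∎)
  where
  open ℚᵘ.≤-Reasoning
  eq : ((2 ℕ.* n) ℕ.+ 0) ℕ.* 1 ≡ (2 ℕ.* n) ℕ.* 1 ℕ.+ 0
  eq = trans (ℕ.*-identityʳ _) (cong (ℕ._+ 0) (sym (ℕ.*-identityʳ (2 ℕ.* n))))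

odd-suc : ∀ n → odd (suc n) ≡ odd n + (+ 2 / 1)
odd-suc n = toℚᵘ-injective (begin-equality
  toℚᵘ (odd (suc n))                    ≃⟨ toℚᵘ-fromℚᵘ (mkℚᵘ (+ suc (2 ℕ.* suc n)) 0) ⟩
  mkℚᵘ (+ suc (2 ℕ.* suc n)) 0          ≃⟨ ℚᵘ.*≡* (cong +_ eq) ⟩
  mkℚᵘ (+ suc (2 ℕ.* n)) 0 ℚᵘ.+ toℚᵘ (+ 2 / 1)  ≃⟨ ℚᵘ.+-congˡ (toℚᵘ (+ 2 / 1)) (toℚᵘ-fromℚᵘ (mkℚᵘ (+ suc (2 ℕ.* n)) 0)) ⟨
  toℚᵘ (odd n) ℚᵘ.+ toℚᵘ (+ 2 / 1)      ≃⟨ toℚᵘ-homo-+ (odd n) (+ 2 / 1) ⟨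
  toℚᵘ (odd n + (+ 2 / 1)) ∎)
  where
  open ℚᵘ.≤-Reasoning
  eq : suc (2 ℕ.* suc n) ℕ.* 1 ≡ (suc (2 ℕ.* n) ℕ.* 1 ℕ.+ 2) ℕ.* 1
  eq = cong (ℕ._* 1) (trans (cong suc (trans (ℕ.*-suc 2 n) (ℕ.+-comm 2 (2 ℕ.* n))))
                            (cong (ℕ._+ 2) (sym (ℕ.*-identityʳ (suc (2 ℕ.* n))))))

0<odd⁻¹ : ∀ n → 0ℚ < odd⁻¹ n
0<odd⁻¹ n = positive⁻¹ (odd⁻¹ n) {{normalize-pos 1 (suc (2 ℕ.* n))}}

0≤odd⁻¹ : ∀ n → 0ℚ ≤ odd⁻¹ n
0≤odd⁻¹ n = <⇒≤ (0<odd⁻¹ n)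

odd⁻¹-diff : ∀ n → odd⁻¹ n - odd⁻¹ (suc n) ≡ (+ 2 / 1) * (odd⁻¹ n * odd⁻¹ (suc n))
odd⁻¹-diff n = begin
  q - q′                                  ≡⟨ cong₂ _-_ (*-identityʳ q) (*-identityʳ q′) ⟨
  q * 1ℚ - q′ * 1ℚ                        ≡⟨ cong₂ (λ a b → q * a - q′ * b) (odd⁻¹*odd (suc n)) (odd⁻¹*odd n) ⟨
  q * (q′ * odd (suc n)) - q′ * (q * o)   ≡⟨ cong (λ a → q * (q′ * a) - q′ * (q * o)) (odd-suc n) ⟩
  q * (q′ * (o + (+ 2 / 1))) - q′ * (q * o) ≡⟨ solve 3 (λ q r o → q :* (r :* (o :+ con (+ 2 / 1))) :- r :* (q :* o) := con (+ 2 / 1) :* (q :* r)) refl q q′ o ⟩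
  (+ 2 / 1) * (q * q′)                    ∎
  where
  open ≡-Reasoning
  q = odd⁻¹ n
  q′ = odd⁻¹ (suc n)
  o = odd n

odd⁻¹-antitone : ∀ n → odd⁻¹ (suc n) ≤ odd⁻¹ n
odd⁻¹-antitone n = 0≤-⇒≤ (subst (0ℚ ≤_) (sym (odd⁻¹-diff n))
  (0≤* {+ 2 / 1} (*≤* (ℤ.+≤+ z≤n)) (0≤* (0≤odd⁻¹ n) (0≤odd⁻¹ (suc n)))))

odd⁻¹≤1 : ∀ n → odd⁻¹ n ≤ 1ℚ
odd⁻¹≤1 zero = ≤-refl
odd⁻¹≤1 (suc n) = ≤-trans (odd⁻¹-antitone n) (odd⁻¹≤1 n)

odd⁻¹≤3odd⁻¹suc : ∀ n → odd⁻¹ n ≤ (+ 3 / 1) * odd⁻¹ (suc n)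
odd⁻¹≤3odd⁻¹suc n = begin
  q                                 ≡⟨ solve 2 (λ a b → a := b :+ (a :- b)) refl q q′ ⟩
  q′ + (q - q′)                     ≡⟨ cong (λ a → q′ + a) (odd⁻¹-diff n) ⟩
  q′ + (+ 2 / 1) * (q * q′)         ≤⟨ +-monoʳ-≤ q′ (*-mono-nonNeg {r = + 2 / 1} (*≤* (ℤ.+≤+ z≤n)) (*-monoʳ-≤-nonNeg q′ {{nonNegative (0≤odd⁻¹ (suc n))}} (odd⁻¹≤1 n))) ⟩
  q′ + (+ 2 / 1) * (1ℚ * q′)        ≡⟨ solve 1 (λ a → a :+ con (+ 2 / 1) :* (con 1ℚ :* a) := con (+ 3 / 1) :* a) refl q′ ⟩
  (+ 3 / 1) * q′                    ∎
  where
  open ≤-Reasoning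
  q = odd⁻¹ n
  q′ = odd⁻¹ (suc n)

odd⁻¹→0 : ∀ ε → 0ℚ < ε → ∃ λ N → ∀ n → N ℕ.≤ n → odd⁻¹ n < ε
odd⁻¹→0 (mkℚ (+ zero) d c) (*<* (ℤ.+<+ ()))
odd⁻¹→0 ε@(mkℚ (+ suc p) d c) _ = suc d , λ n d<n → toℚᵘ-cancel-< (begin-strict
    toℚᵘ (odd⁻¹ n)        ≃⟨ toℚᵘ-fromℚᵘ (mkℚᵘ (+ 1) (2 ℕ.* n)) ⟩
    mkℚᵘ (+ 1) (2 ℕ.* n)  <⟨ ℚᵘ.*<* (ℤ.+<+ (cross n d<n)) ⟩
    toℚᵘ ε                ∎)
  where
  open ℚᵘ.≤-Reasoning
  cross : ∀ n → suc d ℕ.≤ n → 1 ℕ.* suc d ℕ.< suc p ℕ.* suc (2 ℕ.* n)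
  cross n d<n = ℕ.<-≤-trans
    (s≤s (ℕ.≤-trans (ℕ.≤-reflexive (ℕ.+-identityʳ (suc d))) (ℕ.≤-trans d<n (ℕ.m≤m+n n (n ℕ.+ 0)))))
    (ℕ.m≤m+n (suc (2 ℕ.* n)) (p ℕ.* suc (2 ℕ.* n)))
odd⁻¹→0 (mkℚ ℤ.-[1+ p ] d c) (*<* ())

-- π is defined by Leibniz's series π/4 = 1 - 1/3 + 1/5 - ⋯
leibnizSum : ℕ → ℚ
leibnizSum zero    = 0ℚ
leibnizSum (suc n) = leibnizSum n + (- 1ℚ) ^ n * odd⁻¹ n

[-1]^n*[-1]^n : ∀ n → (- 1ℚ) ^ n * (- 1ℚ) ^ n ≡ 1ℚ
[-1]^n*[-1]^n zero = refl
[-1]^n*[-1]^n (suc n) = trans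
  (solve 1 (λ s → (con (- 1ℚ) :* s) :* (con (- 1ℚ) :* s) := s :* s) refl ((- 1ℚ) ^ n))
  ([-1]^n*[-1]^n n)

leibnizTail : ℕ → ℕ → ℚ
leibnizTail j n = (- 1ℚ) ^ n * (leibnizSum (j ℕ.+ n) - leibnizSum n)

leibnizTail-suc : ∀ j n → leibnizTail (suc j) n ≡ odd⁻¹ n - leibnizTail j (suc n)
leibnizTail-suc j n = begin
  s * (leibnizSum (suc j ℕ.+ n) - A)        ≡⟨ cong (λ k → s * (leibnizSum k - A)) (ℕ.+-suc j n) ⟨
  s * (B - A)                               ≡⟨ solve 4 (λ s A B q → s :* (B :- A) := (s :* s) :* q :- (con (- 1ℚ) :* s) :* (B :- (A :+ s :* q))) refl s A B q ⟩
  (s * s) * q - leibnizTail j (suc n)       ≡⟨ cong (λ a → a * q - leibnizTail j (suc n)) ([-1]^n*[-1]^n n) ⟩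
  1ℚ * q - leibnizTail j (suc n)            ≡⟨ cong (_- leibnizTail j (suc n)) (*-identityˡ q) ⟩
  q - leibnizTail j (suc n)                 ∎
  where
  open ≡-Reasoning
  s = (- 1ℚ) ^ n
  A = leibnizSum n
  B = leibnizSum (j ℕ.+ suc n)
  q = odd⁻¹ n

leibnizTail-bounds : ∀ j n → 0ℚ ≤ leibnizTail j n × leibnizTail j n ≤ odd⁻¹ n
leibnizTail-bounds zero n =
  ≤-reflexive (sym eq) , subst (_≤ odd⁻¹ n) (sym eq) (0≤odd⁻¹ n)
  where
  eq : leibnizTail zero n ≡ 0ℚ
  eq = trans (cong ((- 1ℚ) ^ n *_) (+-inverseʳ (leibnizSum n))) (*-zeroʳ ((- 1ℚ) ^ n))
leibnizTail-bounds (suc j) n with leibnizTail-bounds j (suc n)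
... | 0≤t , t≤q = subst (λ a → 0ℚ ≤ a × a ≤ odd⁻¹ n) (sym (leibnizTail-suc j n))
  (≤⇒0≤- (≤-trans t≤q (odd⁻¹-antitone n)) , -‿mono 0≤t)

sgn : Sign → ℚ
sgn Sign.+ = 1ℚ
sgn Sign.- = - 1ℚ

∣sgn^k∣≡1 : ∀ σ k → ∣ sgn σ ^ k ∣ ≡ 1ℚ
∣sgn^k∣≡1 σ zero = refl
∣sgn^k∣≡1 σ (suc k) = trans (∣p*q∣≡∣p∣*∣q∣ (sgn σ) (sgn σ ^ k))
  (trans (cong₂ _*_ (∣sgn∣ σ) (∣sgn^k∣≡1 σ k)) (*-identityˡ 1ℚ))
  where
  ∣sgn∣ : ∀ σ → ∣ sgn σ ∣ ≡ 1ℚ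
  ∣sgn∣ Sign.+ = refl
  ∣sgn∣ Sign.- = refl

leibniz : ℝ
leibniz = mkℝ leibnizSum (symmetrise leibnizSum λ ε 0<ε →
  let N , h = odd⁻¹→0 ε 0<ε in N , λ m n N≤n n≤m → ≤-<-trans (bound m n n≤m) (h n N≤n))
  where
  open ≤-Reasoning
  bound′ : ∀ j n → ∣ leibnizSum (j ℕ.+ n) - leibnizSum n ∣ ≤ odd⁻¹ n
  bound′ j n = begin
    ∣ d ∣                          ≡⟨ *-identityˡ ∣ d ∣ ⟨
    1ℚ * ∣ d ∣                     ≡⟨ cong (_* ∣ d ∣) (∣sgn^k∣≡1 Sign.- n) ⟨
    ∣ (- 1ℚ) ^ n ∣ * ∣ d ∣         ≡⟨ ∣p*q∣≡∣p∣*∣q∣ ((- 1ℚ) ^ n) d ⟨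
    ∣ leibnizTail j n ∣            ≡⟨ 0≤p⇒∣p∣≡p (proj₁ (leibnizTail-bounds j n)) ⟩
    leibnizTail j n                ≤⟨ proj₂ (leibnizTail-bounds j n) ⟩
    odd⁻¹ n                        ∎
    where d = leibnizSum (j ℕ.+ n) - leibnizSum n
  bound : ∀ m n → n ℕ.≤ m → ∣ leibnizSum m - leibnizSum n ∣ ≤ odd⁻¹ n
  bound m n n≤m = subst (λ k → ∣ leibnizSum k - leibnizSum n ∣ ≤ odd⁻¹ n) (ℕ.m∸n+n≡m n≤m) (bound′ (m ℕ.∸ n) n)

π : ℝ
π = real (+ 4 / 1) *ᵣ leibniz

π-positive : Positiveᵣ π
π-positive = δ , positive⁻¹ δ , 1 , bound
  where
  open ≤-Reasoning
  δ = + 8 / 3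
  bound : ∀ n → 1 ℕ.≤ n → δ ≤ (+ 4 / 1) * leibnizSum n
  bound (suc j) _ = *-mono-nonNeg {+ 2 / 3} (*≤* (ℤ.+≤+ z≤n)) (begin
    + 2 / 3                               ≡⟨⟩
    1ℚ + - odd⁻¹ 1                        ≤⟨ +-monoʳ-≤ 1ℚ (neg-antimono-≤ (proj₂ (leibnizTail-bounds j 1))) ⟩
    1ℚ - leibnizTail j 1                  ≡⟨ leibnizTail-suc j 0 ⟨
    1ℚ * (leibnizSum (suc j ℕ.+ 0) - 0ℚ)  ≡⟨ solve 1 (λ a → con 1ℚ :* (a :- con 0ℚ) := a) refl (leibnizSum (suc j ℕ.+ 0)) ⟩
    leibnizSum (suc j ℕ.+ 0)              ≡⟨ cong leibnizSum (ℕ.+-identityʳ (suc j)) ⟩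
    leibnizSum (suc j)                    ∎)

infix 9 _/π

_/π : ℕ → ℝ
k /π = real (+ k / 1) *ᵣ inv π π-positive

⅓ : ℚ
⅓ = + 1 / 3

ratio : ℕ → ℚ
ratio n = 1ℚ - ⅓ * odd⁻¹ n

0<ratio : ∀ n → 0ℚ < ratio n
0<ratio n = <-≤-trans (positive⁻¹ (+ 2 / 3))
  (+-monoʳ-≤ 1ℚ (neg-antimono-≤ (*-mono-nonNeg {r = ⅓} (*≤* (ℤ.+≤+ z≤n)) (odd⁻¹≤1 n))))

-- Comparison sequence for the convergence proofs: 1 / weight n = ∏_{k ≤ n} (1 - 1/(3(2k-1))), so
-- that weight n grows like n^{1/6}, slower than √n but faster than every
-- power of log n.
weight : ℕ → ℚ
weight zero    = 1ℚ
weight (suc n) = weight n * recip (ratio n) (0<ratio n)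

0≤weight : ∀ n → 0ℚ ≤ weight n
0≤weight zero    = *≤* (ℤ.+≤+ z≤n)
0≤weight (suc n) = 0≤* (0≤weight n) (<⇒≤ (0<recip (ratio n) (0<ratio n)))

weight-step : ∀ n → weight n ≡ weight (suc n) * ratio n
weight-step n = begin
  w               ≡⟨ *-identityʳ w ⟨
  w * 1ℚ          ≡⟨ cong (w *_) (*-recip r (0<ratio n)) ⟨
  w * (r * r⁻¹)   ≡⟨ solve 3 (λ w r i → w :* (r :* i) := (w :* i) :* r) refl w r r⁻¹ ⟩
  (w * r⁻¹) * r   ∎
  where
  open ≡-Reasoning
  w = weight n
  r = ratio n
  r⁻¹ = recip r (0<ratio n)

weight-suc : ∀ n → weight (suc n) ≡ weight n + ⅓ * (odd⁻¹ n * weight (suc n))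
weight-suc n = begin
  w′                               ≡⟨ solve 2 (λ w q → w := w :* (con 1ℚ :- con ⅓ :* q) :+ con ⅓ :* (q :* w)) refl w′ q ⟩
  w′ * ratio n + ⅓ * (q * w′)      ≡⟨ cong (_+ ⅓ * (q * w′)) (weight-step n) ⟨
  weight n + ⅓ * (q * w′)          ∎
  where
  open ≡-Reasoning
  w′ = weight (suc n)
  q = odd⁻¹ n

weight-mono : ∀ n → weight n ≤ weight (suc n)
weight-mono n = subst (weight n ≤_) (sym (weight-suc n))
  (p≤p+q (0≤* {⅓} (*≤* (ℤ.+≤+ z≤n)) (0≤* (0≤odd⁻¹ n) (0≤weight (suc n)))))

1≤weight : ∀ n → 1ℚ ≤ weight n
1≤weight zero    = ≤-refl
1≤weight (suc n) = ≤-trans (1≤weight n) (weight-mono n)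

weight²≤ : ∀ n → weight n * weight n * odd⁻¹ n ≤ 1ℚ
weight²≤ zero    = ≤-refl
weight²≤ (suc n) = ≤-trans (0≤-⇒≤ (subst (0ℚ ≤_) (sym eq) nonneg)) (weight²≤ n)
  where
  open ≡-Reasoning
  w′ = weight (suc n)
  q  = odd⁻¹ n
  q′ = odd⁻¹ (suc n)
  X  = w′ * w′ * q * ((⅓ * ⅓) * (q * q) + (+ 2 / 3) * ((+ 3 / 1) * q′ - q))
  nonneg : 0ℚ ≤ X
  nonneg = 0≤* (0≤* (0≤* (0≤weight (suc n)) (0≤weight (suc n))) (0≤odd⁻¹ n))
    (0≤+ (0≤* {⅓ * ⅓} (*≤* (ℤ.+≤+ z≤n)) (0≤* (0≤odd⁻¹ n) (0≤odd⁻¹ n)))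
         (0≤* {+ 2 / 3} (*≤* (ℤ.+≤+ z≤n)) (≤⇒0≤- (odd⁻¹≤3odd⁻¹suc n))))
  eq : weight n * weight n * q - w′ * w′ * q′ ≡ X
  eq = begin
    weight n * weight n * q - w′ * w′ * q′
      ≡⟨ cong (λ w → w * w * q - w′ * w′ * q′) (weight-step n) ⟩
    (w′ * ratio n) * (w′ * ratio n) * q - w′ * w′ * q′
      ≡⟨ solve 3 (λ w q r → (w :* (con 1ℚ :- con ⅓ :* q)) :* (w :* (con 1ℚ :- con ⅓ :* q)) :* q :- w :* w :* r
                   := w :* w :* ((q :- r) :- con (+ 2 / 3) :* (q :* q) :+ (con (⅓ * ⅓)) :* (q :* q :* q))) refl w′ q q′ ⟩
    w′ * w′ * ((q - q′) - (+ 2 / 3) * (q * q) + (⅓ * ⅓) * (q * q * q))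
      ≡⟨ cong (λ d → w′ * w′ * (d - (+ 2 / 3) * (q * q) + (⅓ * ⅓) * (q * q * q))) (odd⁻¹-diff n) ⟩
    w′ * w′ * ((+ 2 / 1) * (q * q′) - (+ 2 / 3) * (q * q) + (⅓ * ⅓) * (q * q * q))
      ≡⟨ solve 3 (λ w q r → w :* w :* (con (+ 2 / 1) :* (q :* r) :- con (+ 2 / 3) :* (q :* q) :+ con (⅓ * ⅓) :* (q :* q :* q))
                   := w :* w :* q :* (con (⅓ * ⅓) :* (q :* q) :+ con (+ 2 / 3) :* (con (+ 3 / 1) :* r :- q))) refl w′ q q′ ⟩
    X ∎

decay : ℕ → ℚ
decay n = weight n * odd⁻¹ n

0≤decay : ∀ n → 0ℚ ≤ decay n
0≤decay n = 0≤* (0≤weight n) (0≤odd⁻¹ n)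

decay-step : ∀ n → ⅓ * (odd⁻¹ n * odd⁻¹ n * weight (suc n)) ≤ decay n - decay (suc n)
decay-step n = 0≤-⇒≤ (subst (0ℚ ≤_) (sym eq) nonneg)
  where
  open ≡-Reasoning
  w′ = weight (suc n)
  q  = odd⁻¹ n
  q′ = odd⁻¹ (suc n)
  X  = w′ * q * ((+ 2 / 3) * ((+ 3 / 1) * q′ - q))
  nonneg : 0ℚ ≤ X
  nonneg = 0≤* (0≤* (0≤weight (suc n)) (0≤odd⁻¹ n))
    (0≤* {+ 2 / 3} (*≤* (ℤ.+≤+ z≤n)) (≤⇒0≤- (odd⁻¹≤3odd⁻¹suc n)))
  eq : (decay n - decay (suc n)) - ⅓ * (q * q * w′) ≡ X
  eq = begin
    (weight n * q - w′ * q′) - ⅓ * (q * q * w′)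
      ≡⟨ cong (λ w → (w * q - w′ * q′) - ⅓ * (q * q * w′)) (weight-step n) ⟩
    ((w′ * ratio n) * q - w′ * q′) - ⅓ * (q * q * w′)
      ≡⟨ solve 3 (λ w q r → ((w :* (con 1ℚ :- con ⅓ :* q)) :* q :- w :* r) :- con ⅓ :* (q :* q :* w)
                   := w :* ((q :- r) :- con (+ 2 / 3) :* (q :* q))) refl w′ q q′ ⟩
    w′ * ((q - q′) - (+ 2 / 3) * (q * q))
      ≡⟨ cong (λ d → w′ * (d - (+ 2 / 3) * (q * q))) (odd⁻¹-diff n) ⟩
    w′ * ((+ 2 / 1) * (q * q′) - (+ 2 / 3) * (q * q))
      ≡⟨ solve 3 (λ w q r → w :* (con (+ 2 / 1) :* (q :* r) :- con (+ 2 / 3) :* (q :* q))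
                   := w :* q :* (con (+ 2 / 3) :* (con (+ 3 / 1) :* r :- q))) refl w′ q q′ ⟩
    X ∎

decay→0 : ∀ ε → 0ℚ < ε → ∃ λ N → ∀ n → N ℕ.≤ n → decay n < ε
decay→0 ε 0<ε = proj₁ Q , λ n N≤n → bound n (proj₂ Q n N≤n)
  where
  open ≤-Reasoning
  Q = odd⁻¹→0 (ε * ε) (0<* 0<ε 0<ε)
  bound : ∀ n → odd⁻¹ n < ε * ε → decay n < ε
  bound n q<ε² with decay n <? ε
  ... | yes d<ε = d<ε
  ... | no d≮ε = contradiction (begin-strict
    ε * ε                                  ≤⟨ *-mono₂ (<⇒≤ 0<ε) (0≤decay n) (≮⇒≥ d≮ε) (≮⇒≥ d≮ε) ⟩
    decay n * decay n                      ≡⟨ solve 2 (λ w q → (w :* q) :* (w :* q) := q :* (w :* w :* q)) refl (weight n) (odd⁻¹ n) ⟩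
    odd⁻¹ n * (weight n * weight n * odd⁻¹ n) ≤⟨ *-mono-nonNeg (0≤odd⁻¹ n) (weight²≤ n) ⟩
    odd⁻¹ n * 1ℚ                           ≡⟨ *-identityʳ (odd⁻¹ n) ⟩
    odd⁻¹ n                                <⟨ q<ε² ⟩
    ε * ε                                  ∎) (<-irrefl refl)

∣f∣-suc : ∀ (f : ℕ → ℚ) n → ∣ f (suc n) ∣ ≤ ∣ f n ∣ + ∣ f (suc n) - f n ∣
∣f∣-suc f n = subst (λ x → ∣ x ∣ ≤ ∣ f n ∣ + ∣ f (suc n) - f n ∣)
  (solve 2 (λ a b → a :+ (b :- a) := b) refl (f n) (f (suc n)))
  (∣p+q∣≤∣p∣+∣q∣ (f n) (f (suc n) - f n))

growth-bound : ∀ (f : ℕ → ℚ) c → 0ℚ ≤ c → f 0 ≡ 0ℚ →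
  (∀ n → ∣ f (suc n) - f n ∣ ≤ odd⁻¹ n * (c * weight (suc n))) →
  ∀ n → ∣ f n ∣ ≤ (+ 3 / 1) * c * weight n
growth-bound f c 0≤c f0 step zero =
  subst (λ x → ∣ x ∣ ≤ (+ 3 / 1) * c * 1ℚ) (sym f0)
    (0≤* (0≤* {+ 3 / 1} (*≤* (ℤ.+≤+ z≤n)) 0≤c) (*≤* (ℤ.+≤+ z≤n)))
growth-bound f c 0≤c f0 step (suc n) = begin
  ∣ f (suc n) ∣
    ≤⟨ ∣f∣-suc f n ⟩
  ∣ f n ∣ + ∣ f (suc n) - f n ∣
    ≤⟨ +-mono-≤ (growth-bound f c 0≤c f0 step n) (step n) ⟩
  (+ 3 / 1) * c * weight n + odd⁻¹ n * (c * w′)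
    ≡⟨ solve 4 (λ c w q v → con (+ 3 / 1) :* c :* w :+ q :* (c :* v)
                 := con (+ 3 / 1) :* c :* (w :+ con ⅓ :* (q :* v))) refl c (weight n) (odd⁻¹ n) w′ ⟩
  (+ 3 / 1) * c * (weight n + ⅓ * (odd⁻¹ n * w′))
    ≡⟨ cong ((+ 3 / 1) * c *_) (weight-suc n) ⟨
  (+ 3 / 1) * c * w′ ∎
  where
  open ≤-Reasoning
  w′ = weight (suc n)

tail-cauchy : ∀ (f : ℕ → ℚ) c → 0ℚ ≤ c →
  (∀ n → ∣ f (suc n) - f n ∣ ≤ odd⁻¹ n * odd⁻¹ n * (c * weight (suc n))) → Cauchy f
tail-cauchy f c 0≤c step = rescale f C 0≤C λ ε 0<ε →
  let N , h = decay→0 ε 0<ε in N , sym-bound N ε h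
  where
  open ≤-Reasoning
  C = (+ 3 / 1) * c
  0≤C : 0ℚ ≤ C
  0≤C = 0≤* {+ 3 / 1} (*≤* (ℤ.+≤+ z≤n)) 0≤c
  tele : ∀ j n → ∣ f (j ℕ.+ n) - f n ∣ ≤ C * (decay n - decay (j ℕ.+ n))
  tele zero n = begin
    ∣ f n - f n ∣             ≡⟨ cong ∣_∣ (+-inverseʳ (f n)) ⟩
    0ℚ                        ≡⟨ *-zeroʳ C ⟨
    C * 0ℚ                    ≡⟨ cong (C *_) (+-inverseʳ (decay n)) ⟨
    C * (decay n - decay n)   ∎
  tele (suc j) n = begin
    ∣ f (suc k) - f n ∣
      ≤⟨ ∣∣-triangle (f (suc k)) (f k) (f n) ⟩
    ∣ f (suc k) - f k ∣ + ∣ f k - f n ∣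
      ≤⟨ +-mono-≤ (step k) (tele j n) ⟩
    q * q * (c * w′) + C * (decay n - decay k)
      ≡⟨ solve 4 (λ q c w d → q :* q :* (c :* w) :+ con (+ 3 / 1) :* c :* d
                   := con (+ 3 / 1) :* c :* (con ⅓ :* (q :* q :* w) :+ d)) refl q c w′ (decay n - decay k) ⟩
    C * (⅓ * (q * q * w′) + (decay n - decay k))
      ≤⟨ *-mono-nonNeg 0≤C (+-monoˡ-≤ (decay n - decay k) (decay-step k)) ⟩
    C * ((decay k - decay (suc k)) + (decay n - decay k))
      ≡⟨ cong (C *_) (solve 3 (λ a b d → (b :- d) :+ (a :- b) := a :- d) refl (decay n) (decay k) (decay (suc k))) ⟩
    C * (decay n - decay (suc k)) ∎
    where
    k = j ℕ.+ n
    q = odd⁻¹ k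
    w′ = weight (suc k)
  bound : ∀ {m n} → n ℕ.≤ m → ∣ f m - f n ∣ ≤ C * decay n
  bound {m} {n} n≤m = ≤-trans
    (subst (λ k → ∣ f k - f n ∣ ≤ C * (decay n - decay k)) (ℕ.m∸n+n≡m n≤m) (tele (m ℕ.∸ n) n))
    (*-mono-nonNeg 0≤C (-‿mono (0≤decay m)))
  sym-bound : ∀ N ε → (∀ n → N ℕ.≤ n → decay n < ε) →
    ∀ m n → N ℕ.≤ m → N ℕ.≤ n → ∣ f m - f n ∣ ≤ C * ε
  sym-bound N ε h m n p q with ℕ.≤-total n m
  ... | inj₁ n≤m = ≤-trans (bound n≤m) (*-mono-nonNeg 0≤C (<⇒≤ (h n q)))
  ... | inj₂ m≤n = subst (_≤ C * ε) (∣p-q∣≡∣q-p∣ (f n) (f m))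
    (≤-trans (bound m≤n) (*-mono-nonNeg 0≤C (<⇒≤ (h m p))))

odd⁻¹^s-nonNeg : ∀ n s → 0ℚ ≤ odd⁻¹ n ^ s
odd⁻¹^s-nonNeg n zero    = *≤* (ℤ.+≤+ z≤n)
odd⁻¹^s-nonNeg n (suc s) = 0≤* (0≤odd⁻¹ n) (odd⁻¹^s-nonNeg n s)

odd⁻¹^s≤1 : ∀ n s → odd⁻¹ n ^ s ≤ 1ℚ
odd⁻¹^s≤1 n zero    = ≤-refl
odd⁻¹^s≤1 n (suc s) = subst (odd⁻¹ n * odd⁻¹ n ^ s ≤_) (*-identityˡ 1ℚ)
  (*-mono₂ (0≤odd⁻¹ n) (*≤* (ℤ.+≤+ z≤n)) (odd⁻¹≤1 n) (odd⁻¹^s≤1 n s))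

odd⁻¹^s≤odd⁻¹ : ∀ n {s} → 1 ℕ.≤ s → odd⁻¹ n ^ s ≤ odd⁻¹ n
odd⁻¹^s≤odd⁻¹ n {suc s} _ = subst (odd⁻¹ n * odd⁻¹ n ^ s ≤_) (*-identityʳ (odd⁻¹ n))
  (*-mono-nonNeg (0≤odd⁻¹ n) (odd⁻¹^s≤1 n s))

odd⁻¹^s≤odd⁻¹² : ∀ n {s} → 1 ℕ.< s → odd⁻¹ n ^ s ≤ odd⁻¹ n * odd⁻¹ n
odd⁻¹^s≤odd⁻¹² n {suc s} (s≤s 1≤s) = *-mono-nonNeg (0≤odd⁻¹ n) (odd⁻¹^s≤odd⁻¹ n 1≤s)

data Admissible : List ℕ → Set where
  admissible : ∀ {s ss} → 1 ℕ.< s → All (1 ℕ.≤_) ss → Admissible (s ∷ ss)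

-- t⋆Sum n s is the truncation k₁ ≤ n of the defining series, and the step
-- from n to suc n adds the terms with k₁ = suc n, so that 2k₁-1 = 2n+1.
t⋆Sum : ℕ → List ℕ → ℚ
t⋆Sum n       []       = 1ℚ
t⋆Sum zero    (s ∷ ss) = 0ℚ
t⋆Sum (suc n) (s ∷ ss) = t⋆Sum n (s ∷ ss) + odd⁻¹ n ^ s * t⋆Sum (suc n) ss

-- The pair (s , σ) stands for the entry s with sign σ.
Letter : Set
Letter = ℕ × Sign

pattern plain s = s , Sign.+
pattern bar s   = s , Sign.-

exponents : List Letter → List ℕ
exponents = map proj₁

-- As for t⋆Sum, but with k₂ ≤ n = k₁ - 1.
tSum : ℕ → List Letter → ℚ
tSum n       []             = 1ℚ
tSum zero    (_ ∷ ps)       = 0ℚ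
tSum (suc n) ((s , σ) ∷ ps) = tSum n ((s , σ) ∷ ps) + (sgn σ ^ suc n * odd⁻¹ n ^ s) * tSum n ps

three^ : ℕ → ℚ
three^ zero    = 1ℚ
three^ (suc r) = (+ 3 / 1) * three^ r

0≤three^ : ∀ r → 0ℚ ≤ three^ r
0≤three^ zero    = *≤* (ℤ.+≤+ z≤n)
0≤three^ (suc r) = 0≤* {+ 3 / 1} (*≤* (ℤ.+≤+ z≤n)) (0≤three^ r)

1*weight-bound : ∀ n → ∣ 1ℚ ∣ ≤ 1ℚ * weight n
1*weight-bound n = subst (1ℚ ≤_) (sym (*-identityˡ (weight n))) (1≤weight n)

add-sub : ∀ a b → (a + b) - a ≡ b
add-sub = solve 2 (λ a b → (a :+ b) :- a := b) refl

t⋆Sum-step : ∀ n s ss {e c} → odd⁻¹ n ^ s ≤ e → 0ℚ ≤ c →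
  ∣ t⋆Sum (suc n) ss ∣ ≤ c * weight (suc n) →
  ∣ t⋆Sum (suc n) (s ∷ ss) - t⋆Sum n (s ∷ ss) ∣ ≤ e * (c * weight (suc n))
t⋆Sum-step n s ss {e} {c} h 0≤c ih = begin
  ∣ t⋆Sum (suc n) (s ∷ ss) - t⋆Sum n (s ∷ ss) ∣
    ≡⟨ cong ∣_∣ (add-sub (t⋆Sum n (s ∷ ss)) (x * y)) ⟩
  ∣ x * y ∣
    ≡⟨ ∣p*q∣≡∣p∣*∣q∣ x y ⟩
  ∣ x ∣ * ∣ y ∣
    ≡⟨ cong (_* ∣ y ∣) (0≤p⇒∣p∣≡p (odd⁻¹^s-nonNeg n s)) ⟩
  x * ∣ y ∣
    ≤⟨ *-mono₂ (odd⁻¹^s-nonNeg n s) (0≤* 0≤c (0≤weight (suc n))) h ih ⟩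
  e * (c * weight (suc n)) ∎
  where
  open ≤-Reasoning
  x = odd⁻¹ n ^ s
  y = t⋆Sum (suc n) ss

tSum-step : ∀ n s σ ps {e c} → odd⁻¹ n ^ s ≤ e → 0ℚ ≤ c →
  ∣ tSum n ps ∣ ≤ c * weight n →
  ∣ tSum (suc n) ((s , σ) ∷ ps) - tSum n ((s , σ) ∷ ps) ∣ ≤ e * (c * weight (suc n))
tSum-step n s σ ps {e} {c} h 0≤c ih = begin
  ∣ tSum (suc n) ((s , σ) ∷ ps) - tSum n ((s , σ) ∷ ps) ∣
    ≡⟨ cong ∣_∣ (add-sub (tSum n ((s , σ) ∷ ps)) ((g * x) * y)) ⟩
  ∣ (g * x) * y ∣
    ≡⟨ trans (∣p*q∣≡∣p∣*∣q∣ (g * x) y) (cong (_* ∣ y ∣) (∣p*q∣≡∣p∣*∣q∣ g x)) ⟩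
  (∣ g ∣ * ∣ x ∣) * ∣ y ∣
    ≡⟨ cong₂ (λ a b → (a * b) * ∣ y ∣) (∣sgn^k∣≡1 σ (suc n)) (0≤p⇒∣p∣≡p (odd⁻¹^s-nonNeg n s)) ⟩
  (1ℚ * x) * ∣ y ∣
    ≡⟨ cong (_* ∣ y ∣) (*-identityˡ x) ⟩
  x * ∣ y ∣
    ≤⟨ *-mono₂ (odd⁻¹^s-nonNeg n s) (0≤* 0≤c (0≤weight (suc n))) h
         (≤-trans ih (*-mono-nonNeg 0≤c (weight-mono n))) ⟩
  e * (c * weight (suc n)) ∎
  where
  open ≤-Reasoning
  g = sgn σ ^ suc n
  x = odd⁻¹ n ^ s
  y = tSum n ps

t⋆Sum-bound : ∀ {ss} → All (1 ℕ.≤_) ss → ∀ n → ∣ t⋆Sum n ss ∣ ≤ three^ (length ss) * weight n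
t⋆Sum-bound []                      n = 1*weight-bound n
t⋆Sum-bound (_∷_ {s} {ss} 1≤s 1≤ss) n =
  growth-bound (λ k → t⋆Sum k (s ∷ ss)) (three^ (length ss)) (0≤three^ (length ss)) refl
    (λ k → t⋆Sum-step k s ss (odd⁻¹^s≤odd⁻¹ k 1≤s) (0≤three^ (length ss)) (t⋆Sum-bound 1≤ss (suc k))) n

tSum-bound : ∀ ps → All (1 ℕ.≤_) (exponents ps) → ∀ n → ∣ tSum n ps ∣ ≤ three^ (length ps) * weight n
tSum-bound []             []           n = 1*weight-bound n
tSum-bound ((s , σ) ∷ ps) (1≤s ∷ 1≤ps) n =
  growth-bound (λ k → tSum k ((s , σ) ∷ ps)) (three^ (length ps)) (0≤three^ (length ps)) refl
    (λ k → tSum-step k s σ ps (odd⁻¹^s≤odd⁻¹ k 1≤s) (0≤three^ (length ps)) (tSum-bound ps 1≤ps k)) n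

t⋆ : (ss : List ℕ) → Admissible ss → ℝ
t⋆ (s ∷ ss) (admissible 1<s 1≤ss) = mkℝ (λ n → t⋆Sum n (s ∷ ss))
  (tail-cauchy (λ n → t⋆Sum n (s ∷ ss)) (three^ (length ss)) (0≤three^ (length ss)) λ n →
    t⋆Sum-step n s ss (odd⁻¹^s≤odd⁻¹² n 1<s) (0≤three^ (length ss)) (t⋆Sum-bound 1≤ss (suc n)))

t : (ps : List Letter) → Admissible (exponents ps) → ℝ
t ((s , σ) ∷ ps) (admissible 1<s 1≤ps) = mkℝ (λ n → tSum n ((s , σ) ∷ ps))
  (tail-cauchy (λ n → tSum n ((s , σ) ∷ ps)) (three^ (length ps)) (0≤three^ (length ps)) λ n →
    tSum-step n s σ ps (odd⁻¹^s≤odd⁻¹² n 1<s) (0≤three^ (length ps)) (tSum-bound ps 1≤ps n))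

twos : ℕ → List ℕ
twos a = replicate a 2

twos-positive : ∀ a {ss} → All (1 ℕ.≤_) ss → All (1 ℕ.≤_) (twos a ++ ss)
twos-positive a h = ++⁺ (replicate⁺ a (s≤s z≤n)) h

twos-admissible : ∀ {a ss} → 1 ℕ.≤ a → All (1 ℕ.≤_) ss → Admissible (twos a ++ ss)
twos-admissible {suc a} _ h = admissible (s≤s (s≤s z≤n)) (twos-positive a h)

t⋆-adm : ∀ {a} b {s} c → 1 ℕ.≤ a → 1 ℕ.≤ s → Admissible (twos a ++ 1 ∷ twos b ++ s ∷ twos c)
t⋆-adm b c 1≤a 1≤s =
  twos-admissible 1≤a (s≤s z≤n ∷ twos-positive b (1≤s ∷ replicate⁺ c (s≤s z≤n)))

1≤m+1+k : ∀ m {k} → 1 ℕ.≤ m ℕ.+ suc k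
1≤m+1+k m {k} = ℕ.≤-trans (s≤s z≤n) (ℕ.m≤n+m (suc k) m)

1<m+2+k : ∀ m {k} → 1 ℕ.< m ℕ.+ suc (suc k)
1<m+2+k m {k} = ℕ.≤-trans (s≤s (s≤s z≤n)) (ℕ.m≤n+m (suc (suc k)) m)

1<2a+1 : ∀ {a} → 1 ℕ.≤ a → 1 ℕ.< 2 ℕ.* a ℕ.+ 1
1<2a+1 1≤a = ℕ.+-monoˡ-≤ 1 (ℕ.≤-trans 1≤a (ℕ.m≤m+n _ _))

{-# OPTIONS --safe #-}
module Submission where

-- With x = 2n+1 and y = 2k+1, let c(n,k) be the coefficients of the partial fraction expansion
--   ∏_{j ≤ n} (1 - z²/(2j+1)²)⁻¹ = ∑_{k ≤ n} c(n,k) (-1)^k y⁻¹ (1 - z²/y²)⁻¹.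
-- They satisfy (x+y+2) c(n,k+1) = (x-y) c(n,k) and c(n,k) - c(n-1,k) = (y²/x²) c(n,k).
-- The second relation shows that if the truncated star sums of an index s are ∑_k c(n,k) f(k),
-- those of (2,s) are ∑_k c(n,k) f(k)/y²; the first one, by summation by parts, does the same for
-- (1,s) with f replaced by (f(k) + 2 ∑_{j<k} f(j))/y, and for (3,s) with a similar alternating sum.
-- Starting from the empty index, f(k) = (-1)^k/y, this expresses the truncated star sums exactly as
-- ∑_k c(n,k) (H(k+1) - H(k)), H being the partial sums of π/4 times the claimed right-hand side.
-- Summing by parts again gives averages of H with weights c(n,k) - c(n,k+1) ≥ 0, so that the
-- expression is c(n,0) H(n+1) + o(1). The empty index, for which H is Leibniz's sum and the
-- star sum is 1, shows in the same way that c(n,0) tends to 4/π.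

module Truncations where

  open import Algebra.Bundles using (CommutativeRing)
  open import Data.Integer.Base using (+_; +≤+)
  open import Data.List using (List; []; _∷_; _++_)
  open import Data.List.Properties using (++-identityʳ)
  open import Data.Nat.Base as ℕ using (ℕ; zero; suc; z≤n; s≤s)
  import Data.Nat.Properties as ℕ
  import Data.Nat.Solver as ℕ-Solver
  open import Data.Product using (∃; _×_; _,_; proj₁; proj₂)
  open import Data.Rational.Base hiding (_≃_)
  open import Data.Rational.Properties
  open import Data.Rational.Solver using (module +-*-Solver)
  open import Data.Sign.Base as Sign using ()
  open import Data.Sum as Sum using (_⊎_; inj₁; inj₂)
  open import Relation.Binary.PropositionalEquality
  open import Algebra.Properties.Semiring.Exp (CommutativeRing.semiring +-*-commutativeRing) using (_^_; ^-homo-*)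
  open import Defs

  open +-*-Solver using (solve; con; _:+_; _:*_; _:-_; :-_; _:=_)
  open ℕ-Solver.+-*-Solver using () renaming (solve to solveℕ; con to conℕ; _:+_ to _:+ℕ_; _:=_ to _:=ℕ_)

  -- Positive rationals and odd numbers

  2ℚ 3ℚ 4ℚ : ℚ
  2ℚ = + 2 / 1
  3ℚ = + 3 / 1
  4ℚ = + 4 / 1

  *-cancelʳ-pos : ∀ p q r → 0ℚ < r → p * r ≡ q * r → p ≡ q
  *-cancelʳ-pos p q r 0<r eq = begin
    p                        ≡⟨ expand p ⟩
    p * r * recip r 0<r      ≡⟨ cong (_* recip r 0<r) eq ⟩
    q * r * recip r 0<r      ≡⟨ expand q ⟨
    q                        ∎
    where
    open ≡-Reasoning
    expand : ∀ x → x ≡ x * r * recip r 0<r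
    expand x = trans (sym (*-identityʳ x))
      (trans (cong (x *_) (sym (*-recip r 0<r))) (sym (*-assoc x r (recip r 0<r))))

  0<+ : ∀ {p q} → 0ℚ < p → 0ℚ ≤ q → 0ℚ < p + q
  0<+ 0<p 0≤q = <-≤-trans 0<p (p≤p+q 0≤q)

  0<odd : ∀ n → 0ℚ < odd n
  0<odd zero    = positive⁻¹ 1ℚ
  0<odd (suc n) = subst (0ℚ <_) (sym (odd-suc n)) (0<+ (0<odd n) (*≤* (+≤+ z≤n)))

  0≤odd : ∀ n → 0ℚ ≤ odd n
  0≤odd n = <⇒≤ (0<odd n)

  odd-mono : ∀ {k n} → k ℕ.≤ n → odd k ≤ odd n
  odd-mono {k} {n} k≤n = subst (λ m → odd k ≤ odd m) (ℕ.m∸n+n≡m k≤n) (go (n ℕ.∸ k))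
    where
    go : ∀ j → odd k ≤ odd (j ℕ.+ k)
    go zero    = ≤-refl
    go (suc j) = ≤-trans (go j)
      (subst (odd (j ℕ.+ k) ≤_) (sym (odd-suc (j ℕ.+ k))) (p≤p+q (*≤* (+≤+ z≤n))))

  -- Finite sums

  ∑ : ℕ → (ℕ → ℚ) → ℚ
  ∑ zero    f = 0ℚ
  ∑ (suc n) f = ∑ n f + f n

  ∑-cong : ∀ n {f g : ℕ → ℚ} → (∀ k → f k ≡ g k) → ∑ n f ≡ ∑ n g
  ∑-cong zero    h = refl
  ∑-cong (suc n) h = cong₂ _+_ (∑-cong n h) (h n)

  ∑-+ : ∀ n (f g : ℕ → ℚ) → ∑ n (λ k → f k + g k) ≡ ∑ n f + ∑ n g
  ∑-+ zero    f g = refl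
  ∑-+ (suc n) f g = trans (cong (_+ (f n + g n)) (∑-+ n f g))
    (solve 4 (λ a b c d → (a :+ b) :+ (c :+ d) := (a :+ c) :+ (b :+ d)) refl (∑ n f) (∑ n g) (f n) (g n))

  ∑-* : ∀ n c (f : ℕ → ℚ) → ∑ n (λ k → c * f k) ≡ c * ∑ n f
  ∑-* zero    c f = sym (*-zeroʳ c)
  ∑-* (suc n) c f = trans (cong (_+ c * f n) (∑-* n c f)) (sym (*-distribˡ-+ c (∑ n f) (f n)))

  -- The expansion coefficients

  0<1+odd : ∀ n → 0ℚ < odd n + 1ℚ
  0<1+odd n = 0<+ (0<odd n) (*≤* (+≤+ z≤n))

  0<3+odd : ∀ n → 0ℚ < odd n + 3ℚ
  0<3+odd n = 0<+ (0<odd n) (*≤* (+≤+ z≤n))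

  0<odd+odd : ∀ n k → 0ℚ < odd n + odd k
  0<odd+odd n k = 0<+ (0<odd n) (0≤odd k)

  -- The partial Wallis product ∏_{1 ≤ j ≤ n} (2j+1)²/((2j+1)²-1), whose limit is 4/π. The
  -- denominator is split as (x+1)(x+3) with x = `odd n`, so that both reciprocals are of visibly
  -- positive numbers.
  wallis : ℕ → ℚ
  wallis zero    = 1ℚ
  wallis (suc n) =
    wallis n * (odd (suc n) * odd (suc n)) * (recip (odd n + 1ℚ) (0<1+odd n) * recip (odd n + 3ℚ) (0<3+odd n))

  -- In closed form this is `wallis n` times binom(2n+1,n-k)/binom(2n+1,n) for k ≤ n. The recursion
  -- in k is the form in which the coefficients enter summation by parts.
  coeff : ℕ → ℕ → ℚ
  coeff n zero    = wallis n
  coeff n (suc k) = coeff n k * (odd n - odd k) * recip (odd n + odd (suc k)) (0<odd+odd n (suc k))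

  coeff-suc : ∀ n k → (odd n + odd (suc k)) * coeff n (suc k) ≡ (odd n - odd k) * coeff n k
  coeff-suc n k = begin
    s * (c * d * s⁻¹)   ≡⟨ solve 4 (λ s c d i → s :* (c :* d :* i) := d :* c :* (s :* i)) refl s c d s⁻¹ ⟩
    d * c * (s * s⁻¹)   ≡⟨ cong (d * c *_) (*-recip s (0<odd+odd n (suc k))) ⟩
    d * c * 1ℚ          ≡⟨ *-identityʳ (d * c) ⟩
    d * c               ∎
    where
    open ≡-Reasoning
    s = odd n + odd (suc k)
    s⁻¹ = recip s (0<odd+odd n (suc k))
    d = odd n - odd k
    c = coeff n k

  wallis-suc : ∀ n → (odd (suc n) * odd (suc n) - 1ℚ) * wallis (suc n) ≡ odd (suc n) * odd (suc n) * wallis n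
  wallis-suc n = cancel (odd n) (odd (suc n)) (wallis n) (recip (odd n + 1ℚ) (0<1+odd n)) (recip (odd n + 3ℚ) (0<3+odd n))
    (odd-suc n) (*-recip (odd n + 1ℚ) (0<1+odd n)) (*-recip (odd n + 3ℚ) (0<3+odd n))
    where
    open ≡-Reasoning
    -- Variables replace the compound terms, so that what remains for the ring solver is a
    -- polynomial identity; the later local lemmas have the same purpose.
    cancel : ∀ x x′ w r s → x′ ≡ x + 2ℚ → (x + 1ℚ) * r ≡ 1ℚ → (x + 3ℚ) * s ≡ 1ℚ →
      (x′ * x′ - 1ℚ) * (w * (x′ * x′) * (r * s)) ≡ x′ * x′ * w
    cancel x _ w r s refl hr hs = begin
      ((x + 2ℚ) * (x + 2ℚ) - 1ℚ) * (w * z * (r * s))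
        ≡⟨ solve 5 (λ x w z r s → ((x :+ con 2ℚ) :* (x :+ con 2ℚ) :- con 1ℚ) :* (w :* z :* (r :* s))
             := ((x :+ con 1ℚ) :* r) :* ((x :+ con 3ℚ) :* s) :* (z :* w)) refl x w z r s ⟩
      ((x + 1ℚ) * r) * ((x + 3ℚ) * s) * (z * w)
        ≡⟨ cong₂ (λ u v → u * v * (z * w)) hr hs ⟩
      1ℚ * 1ℚ * (z * w)
        ≡⟨ *-identityˡ (z * w) ⟩
      z * w ∎
      where z = (x + 2ℚ) * (x + 2ℚ)

  -- Induction on k. With x′ = x+2 and y′ = y+2 one has x′-y′ = x-y and x+y′ = x′+y, so after
  -- multiplication by x+y′ > 0 the recursions in k of the rows n+1 and n reduce the claim at k+1 to
  -- (x-y) times the claim at k.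
  coeff-sucˡ : ∀ n k →
    (odd (suc n) * odd (suc n) - odd k * odd k) * coeff (suc n) k ≡ odd (suc n) * odd (suc n) * coeff n k
  coeff-sucˡ n zero    = wallis-suc n
  coeff-sucˡ n (suc k) = step (odd n) (odd (suc n)) (odd k) (odd (suc k))
    (coeff n k) (coeff n (suc k)) (coeff (suc n) k) (coeff (suc n) (suc k)) (odd-suc n) (odd-suc k) (0<odd+odd n (suc k))
    (coeff-suc n k) (coeff-suc (suc n) k) (coeff-sucˡ n k)
    where
    open ≡-Reasoning
    step : ∀ x x′ y y′ c₀ c₁ c′₀ c′₁ → x′ ≡ x + 2ℚ → y′ ≡ y + 2ℚ → 0ℚ < x + y′ →
      (x + y′) * c₁ ≡ (x - y) * c₀ → (x′ + y′) * c′₁ ≡ (x′ - y) * c′₀ →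
      (x′ * x′ - y * y) * c′₀ ≡ x′ * x′ * c₀ →
      (x′ * x′ - y′ * y′) * c′₁ ≡ x′ * x′ * c₁
    step x x′ y y′ c₀ c₁ c′₀ c′₁ refl refl 0<x+y′ h h′ ih = *-cancelʳ-pos ((x′ * x′ - y′ * y′) * c′₁) (x′ * x′ * c₁) (x + y′) 0<x+y′ (begin
      (x′ * x′ - y′ * y′) * c′₁ * (x + y′)
        ≡⟨ solve 3 (λ x y c → ((x :+ con 2ℚ) :* (x :+ con 2ℚ) :- (y :+ con 2ℚ) :* (y :+ con 2ℚ)) :* c :* (x :+ (y :+ con 2ℚ))
             := (x :- y) :* (x :+ con 2ℚ :+ y) :* (((x :+ con 2ℚ) :+ (y :+ con 2ℚ)) :* c)) refl x y c′₁ ⟩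
      (x - y) * (x′ + y) * ((x′ + y′) * c′₁)
        ≡⟨ cong ((x - y) * (x′ + y) *_) h′ ⟩
      (x - y) * (x′ + y) * ((x′ - y) * c′₀)
        ≡⟨ solve 4 (λ d x y c → d :* (x :+ y) :* ((x :- y) :* c) := d :* ((x :* x :- y :* y) :* c)) refl (x - y) x′ y c′₀ ⟩
      (x - y) * ((x′ * x′ - y * y) * c′₀)
        ≡⟨ cong ((x - y) *_) ih ⟩
      (x - y) * (x′ * x′ * c₀)
        ≡⟨ solve 3 (λ d z c → d :* (z :* c) := z :* (d :* c)) refl (x - y) (x′ * x′) c₀ ⟩
      x′ * x′ * ((x - y) * c₀)
        ≡⟨ cong (x′ * x′ *_) h ⟨
      x′ * x′ * ((x + y′) * c₁)
        ≡⟨ solve 3 (λ z s c → z :* (s :* c) := z :* c :* s) refl (x′ * x′) (x + y′) c₁ ⟩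
      x′ * x′ * c₁ * (x + y′) ∎)

  -- This is `coeff-sucˡ` divided by the square of `odd (suc n)`. It has the shape of the recursion
  -- of `t⋆Sum` for a leading entry 2, which is what ties the coefficients to star sums.
  coeff-increment : ∀ n k →
    coeff (suc n) k ≡ coeff n k + odd⁻¹ (suc n) ^ 2 * (odd k * odd k * coeff (suc n) k)
  coeff-increment n k = divide (odd⁻¹ (suc n)) (odd (suc n)) (odd k) (coeff n k) (coeff (suc n) k)
    (odd⁻¹*odd (suc n)) (coeff-sucˡ n k)
    where
    open ≡-Reasoning
    divide : ∀ q x y c c′ → q * x ≡ 1ℚ → (x * x - y * y) * c′ ≡ x * x * c → c′ ≡ c + q ^ 2 * (y * y * c′)
    divide q x y c c′ qx h = begin
      c′
        ≡⟨ *-identityˡ c′ ⟨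
      1ℚ * 1ℚ * c′
        ≡⟨ cong (λ z → z * z * c′) qx ⟨
      (q * x) * (q * x) * c′
        ≡⟨ solve 4 (λ q x y c → (q :* x) :* (q :* x) :* c
             := q :* q :* ((x :* x :- y :* y) :* c) :+ q :* (q :* con 1ℚ) :* (y :* y :* c)) refl q x y c′ ⟩
      q * q * ((x * x - y * y) * c′) + q ^ 2 * (y * y * c′)
        ≡⟨ cong (λ z → q * q * z + q ^ 2 * (y * y * c′)) h ⟩
      q * q * (x * x * c) + q ^ 2 * (y * y * c′)
        ≡⟨ cong (_+ q ^ 2 * (y * y * c′)) (solve 3 (λ q x c → q :* q :* (x :* x :* c) := (q :* x) :* (q :* x) :* c) refl q x c) ⟩
      (q * x) * (q * x) * c + q ^ 2 * (y * y * c′)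
        ≡⟨ cong (λ z → z * z * c + q ^ 2 * (y * y * c′)) qx ⟩
      1ℚ * 1ℚ * c + q ^ 2 * (y * y * c′)
        ≡⟨ cong (_+ q ^ 2 * (y * y * c′)) (*-identityˡ c) ⟩
      c + q ^ 2 * (y * y * c′) ∎

  -- Passing from k = n to k = n+1 multiplies by `odd n - odd n`, and all later coefficients of the
  -- row are multiples of the one so obtained.
  coeff-vanishes : ∀ {n k} → n ℕ.< k → coeff n k ≡ 0ℚ
  coeff-vanishes {n} {suc k} (s≤s n≤k) = annihilate (coeff n k) (odd n - odd k)
    (recip (odd n + odd (suc k)) (0<odd+odd n (suc k))) (Sum.map coeff-vanishes n≡k⇒0 (ℕ.m≤n⇒m<n∨m≡n n≤k))
    where
    n≡k⇒0 : n ≡ k → odd n - odd k ≡ 0ℚ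
    n≡k⇒0 refl = +-inverseʳ (odd n)
    annihilate : ∀ c d r → c ≡ 0ℚ ⊎ d ≡ 0ℚ → c * d * r ≡ 0ℚ
    annihilate c d r (inj₁ refl) = solve 2 (λ d r → con 0ℚ :* d :* r := con 0ℚ) refl d r
    annihilate c d r (inj₂ refl) = solve 2 (λ c r → c :* con 0ℚ :* r := con 0ℚ) refl c r

  0≤wallis : ∀ n → 0ℚ ≤ wallis n
  0≤wallis zero    = *≤* (+≤+ z≤n)
  0≤wallis (suc n) = 0≤*
    {wallis n * (odd (suc n) * odd (suc n))}
    {recip (odd n + 1ℚ) (0<1+odd n) * recip (odd n + 3ℚ) (0<3+odd n)}
    (0≤* {wallis n} {odd (suc n) * odd (suc n)} (0≤wallis n) (0≤* {odd (suc n)} {odd (suc n)} (0≤odd (suc n)) (0≤odd (suc n))))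
    (0≤* {recip (odd n + 1ℚ) (0<1+odd n)} {recip (odd n + 3ℚ) (0<3+odd n)}
      (<⇒≤ (0<recip (odd n + 1ℚ) (0<1+odd n))) (<⇒≤ (0<recip (odd n + 3ℚ) (0<3+odd n))))

  0≤coeff : ∀ n k → 0ℚ ≤ coeff n k
  0≤coeff n zero    = 0≤wallis n
  -- For k > n the factor `odd n - odd k` is negative, but there the coefficient is already zero.
  0≤coeff n (suc k) = Sum.[ (λ n<k → ≤-reflexive (sym (coeff-vanishes (ℕ.m≤n⇒m≤1+n n<k)))) , inside ]′ (ℕ.<-≤-connex n k)
    where
    inside : k ℕ.≤ n → 0ℚ ≤ coeff n (suc k)
    inside k≤n = 0≤* {coeff n k * (odd n - odd k)} {recip (odd n + odd (suc k)) (0<odd+odd n (suc k))}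
      (0≤* {coeff n k} {odd n - odd k} (0≤coeff n k) (≤⇒0≤- {odd k} {odd n} (odd-mono k≤n)))
      (<⇒≤ (0<recip (odd n + odd (suc k)) (0<odd+odd n (suc k))))

  coeff-end : ∀ n → coeff n (suc n) ≡ 0ℚ
  coeff-end n = coeff-vanishes {n} {suc n} ℕ.≤-refl

  -- Summation by parts with an explicit boundary term. By `coeff-suc` the boundary term at m+1
  -- equals (x-y) c(n,m) S(m+1), where y = `odd m`; together with the new summand it makes up the
  -- old boundary term plus x c(n,m) (S(m+1) - S(m)).
  abel-partial : ∀ n (S : ℕ → ℚ) → S 0 ≡ 0ℚ → ∀ m →
    ∑ m (λ k → coeff n k * (odd k * (S k + S (suc k)))) + (odd n + odd m) * (coeff n m * S m)
    ≡ odd n * ∑ m (λ k → coeff n k * (S (suc k) - S k))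
  abel-partial n S S0 zero = trans
    (cong (λ s → 0ℚ + (odd n + 1ℚ) * (wallis n * s)) S0)
    (solve 2 (λ x w → con 0ℚ :+ (x :+ con 1ℚ) :* (w :* con 0ℚ) := x :* con 0ℚ) refl (odd n) (wallis n))
  abel-partial n S S0 (suc m) =
    step (odd n) (odd m) (odd (suc m)) (coeff n m) (coeff n (suc m)) (S m) (S (suc m))
      (∑ m (λ k → coeff n k * (odd k * (S k + S (suc k))))) (∑ m (λ k → coeff n k * (S (suc k) - S k)))
      (coeff-suc n m) (abel-partial n S S0 m)
    where
    open ≡-Reasoning
    step : ∀ x y y′ c c′ s s′ P Q → (x + y′) * c′ ≡ (x - y) * c → P + (x + y) * (c * s) ≡ x * Q →
      (P + c * (y * (s + s′))) + (x + y′) * (c′ * s′) ≡ x * (Q + c * (s′ - s))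
    step x y y′ c c′ s s′ P Q h ih = begin
      (P + c * (y * (s + s′))) + (x + y′) * (c′ * s′)
        ≡⟨ cong (λ z → (P + c * (y * (s + s′))) + z) (*-assoc (x + y′) c′ s′) ⟨
      (P + c * (y * (s + s′))) + (x + y′) * c′ * s′
        ≡⟨ cong (λ z → (P + c * (y * (s + s′))) + z * s′) h ⟩
      (P + c * (y * (s + s′))) + (x - y) * c * s′
        ≡⟨ solve 6 (λ P x y c s s′ → (P :+ c :* (y :* (s :+ s′))) :+ (x :- y) :* c :* s′
             := (P :+ (x :+ y) :* (c :* s)) :+ x :* (c :* (s′ :- s))) refl P x y c s s′ ⟩
      (P + (x + y) * (c * s)) + x * (c * (s′ - s))
        ≡⟨ cong (_+ x * (c * (s′ - s))) ih ⟩
      x * Q + x * (c * (s′ - s))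
        ≡⟨ *-distribˡ-+ x Q (c * (s′ - s)) ⟨
      x * (Q + c * (s′ - s)) ∎

  drop-zero : ∀ p r {z} s → z ≡ 0ℚ → p + r * (z * s) ≡ p
  drop-zero p r s refl = solve 3 (λ p r s → p :+ r :* (con 0ℚ :* s) := p) refl p r s

  -- Over a complete row the boundary term disappears, because c(n,n+1) = 0.
  abel : ∀ n (S : ℕ → ℚ) → S 0 ≡ 0ℚ →
    ∑ (suc n) (λ k → coeff n k * (odd k * (S k + S (suc k))))
    ≡ odd n * ∑ (suc n) (λ k → coeff n k * (S (suc k) - S k))
  abel n S S0 = trans
    (sym (drop-zero (∑ (suc n) (λ k → coeff n k * (odd k * (S k + S (suc k)))))
      (odd n + odd (suc n)) (S (suc n)) (coeff-end n)))
    (abel-partial n S S0 (suc n))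

  -- Expansions of truncated star sums

  -- The truncation k₁ ≤ n+1 has largest denominator base `odd n`, so it is matched with row n of
  -- the coefficients. A record, unlike a plain function type, lets the index and the function be
  -- inferred.
  record Expands (ss : List ℕ) (f : ℕ → ℚ) : Set where
    constructor expands
    field
      expansion : ∀ n → t⋆Sum (suc n) ss ≡ ∑ (suc n) (λ k → coeff n k * f k)
  open Expands

  expands-cong : ∀ {ss} {f g : ℕ → ℚ} → (∀ k → f k ≡ g k) → Expands ss f → Expands ss g
  expands-cong f≗g (expands e) = expands λ n →
    trans (e n) (∑-cong (suc n) (λ k → cong (coeff n k *_) (f≗g k)))

  -- `coeff-increment` summed over k ≤ n+1; row n contributes nothing at k = n+1, which shortens its
  -- sum by one term.
  expansion-suc : ∀ (g : ℕ → ℚ) n →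
    ∑ (suc (suc n)) (λ k → coeff (suc n) k * g k)
    ≡ ∑ (suc n) (λ k → coeff n k * g k)
      + odd⁻¹ (suc n) ^ 2 * ∑ (suc (suc n)) (λ k → coeff (suc n) k * (odd k * odd k * g k))
  expansion-suc g n = begin
    ∑ (suc (suc n)) (λ k → coeff (suc n) k * g k)
      ≡⟨ ∑-cong (suc (suc n)) pointwise ⟩
    ∑ (suc (suc n)) (λ k → coeff n k * g k + q² * (coeff (suc n) k * (odd k * odd k * g k)))
      ≡⟨ ∑-+ (suc (suc n)) (λ k → coeff n k * g k) (λ k → q² * (coeff (suc n) k * (odd k * odd k * g k))) ⟩
    (A + coeff n (suc n) * g (suc n)) + ∑ (suc (suc n)) (λ k → q² * (coeff (suc n) k * (odd k * odd k * g k)))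
      ≡⟨ cong₂ _+_ last (∑-* (suc (suc n)) q² (λ k → coeff (suc n) k * (odd k * odd k * g k))) ⟩
    A + q² * ∑ (suc (suc n)) (λ k → coeff (suc n) k * (odd k * odd k * g k)) ∎
    where
    open ≡-Reasoning
    q² = odd⁻¹ (suc n) ^ 2
    A = ∑ (suc n) (λ k → coeff n k * g k)
    distribute : ∀ c c′ p y g → c′ ≡ c + p * (y * c′) → c′ * g ≡ c * g + p * (c′ * (y * g))
    distribute c c′ p y g h = trans (cong (_* g) h)
      (solve 5 (λ c c′ p y g → (c :+ p :* (y :* c′)) :* g := c :* g :+ p :* (c′ :* (y :* g))) refl c c′ p y g)
    pointwise : ∀ k → coeff (suc n) k * g k ≡ coeff n k * g k + q² * (coeff (suc n) k * (odd k * odd k * g k))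
    pointwise k = distribute (coeff n k) (coeff (suc n) k) q² (odd k * odd k) (g k) (coeff-increment n k)
    last : A + coeff n (suc n) * g (suc n) ≡ A
    last = trans (cong (λ z → A + z * g (suc n)) (coeff-end n))
      (solve 2 (λ a g → a :+ con 0ℚ :* g := a) refl A (g (suc n)))

  -- The hypothesis says that the increment of the star sum, an entry s in front of the expansion of
  -- `ss`, is the increment given by `expansion-suc`. Both sides then agree by induction on n,
  -- starting from c(0,0) = 1 and the empty truncation.
  expands-∷ : ∀ s {ss} (f g : ℕ → ℚ) →
    (∀ n → odd⁻¹ n ^ s * ∑ (suc n) (λ k → coeff n k * f k)
         ≡ odd⁻¹ n ^ 2 * ∑ (suc n) (λ k → coeff n k * (odd k * odd k * g k))) →
    Expands ss f → Expands (s ∷ ss) g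
  expands-∷ s {ss} f g h (expands e) = expands go
    where
    open ≡-Reasoning
    go : ∀ n → t⋆Sum (suc n) (s ∷ ss) ≡ ∑ (suc n) (λ k → coeff n k * g k)
    go zero = begin
      0ℚ + odd⁻¹ 0 ^ s * t⋆Sum 1 ss
        ≡⟨ cong (λ z → 0ℚ + odd⁻¹ 0 ^ s * z) (e 0) ⟩
      0ℚ + odd⁻¹ 0 ^ s * ∑ 1 (λ k → coeff 0 k * f k)
        ≡⟨ cong (λ z → 0ℚ + z) (h 0) ⟩
      0ℚ + odd⁻¹ 0 ^ 2 * ∑ 1 (λ k → coeff 0 k * (odd k * odd k * g k))
        ≡⟨ solve 1 (λ g → con 0ℚ :+ con 1ℚ :* (con 0ℚ :+ con 1ℚ :* (con 1ℚ :* g)) := con 0ℚ :+ con 1ℚ :* g) refl (g 0) ⟩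
      0ℚ + 1ℚ * g 0 ∎
    go (suc n) = begin
      t⋆Sum (suc n) (s ∷ ss) + odd⁻¹ (suc n) ^ s * t⋆Sum (suc (suc n)) ss
        ≡⟨ cong₂ (λ u v → u + odd⁻¹ (suc n) ^ s * v) (go n) (e (suc n)) ⟩
      ∑ (suc n) (λ k → coeff n k * g k) + odd⁻¹ (suc n) ^ s * ∑ (suc (suc n)) (λ k → coeff (suc n) k * f k)
        ≡⟨ cong (λ z → ∑ (suc n) (λ k → coeff n k * g k) + z) (h (suc n)) ⟩
      ∑ (suc n) (λ k → coeff n k * g k)
        + odd⁻¹ (suc n) ^ 2 * ∑ (suc (suc n)) (λ k → coeff (suc n) k * (odd k * odd k * g k))
        ≡⟨ expansion-suc g n ⟨
      ∑ (suc (suc n)) (λ k → coeff (suc n) k * g k) ∎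

  odd²*odd⁻¹² : ∀ k f → odd k * odd k * (odd⁻¹ k ^ 2 * f) ≡ f
  odd²*odd⁻¹² k f = cancel (odd⁻¹ k) (odd k) (odd⁻¹*odd k)
    where
    cancel : ∀ q y → q * y ≡ 1ℚ → y * y * (q ^ 2 * f) ≡ f
    cancel q y qy = trans
      (solve 3 (λ q y f → y :* y :* (q :* (q :* con 1ℚ) :* f) := (q :* y) :* (q :* y) :* f) refl q y f)
      (trans (cong (λ z → z * z * f) qy) (*-identityˡ f))

  -- For s = 2 the powers of `odd⁻¹ n` on the two sides of the condition in `expands-∷` coincide, so
  -- y² g = f suffices.
  expands-2 : ∀ {ss} (f : ℕ → ℚ) → Expands ss f → Expands (2 ∷ ss) (λ k → odd⁻¹ k ^ 2 * f k)
  expands-2 f = expands-∷ 2 f (λ k → odd⁻¹ k ^ 2 * f k) λ n →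
    cong (odd⁻¹ n ^ 2 *_) (∑-cong (suc n) λ k → cong (coeff n k *_) (sym (odd²*odd⁻¹² k (f k))))

  expands-twos : ∀ a {ss} (f : ℕ → ℚ) → Expands ss f → Expands (twos a ++ ss) (λ k → odd⁻¹ k ^ (2 ℕ.* a) * f k)
  expands-twos zero    f e = expands-cong (λ k → sym (*-identityˡ (f k))) e
  expands-twos (suc a) f e = expands-cong merge
    (expands-2 (λ k → odd⁻¹ k ^ (2 ℕ.* a) * f k) (expands-twos a f e))
    where
    merge : ∀ k → odd⁻¹ k ^ 2 * (odd⁻¹ k ^ (2 ℕ.* a) * f k) ≡ odd⁻¹ k ^ (2 ℕ.* suc a) * f k
    merge k = trans (sym (*-assoc (odd⁻¹ k ^ 2) (odd⁻¹ k ^ (2 ℕ.* a)) (f k)))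
      (cong (_* f k) (trans (sym (^-homo-* (odd⁻¹ k) 2 (2 ℕ.* a))) (cong (odd⁻¹ k ^_) (sym (ℕ.*-suc 2 a)))))

  -- For s = 1 a factor x = `odd n` is missing, and `abel` supplies it: x times the sum of c(n,k)
  -- f(k) is the sum of c(n,k) y (S(k) + S(k+1)), where S sums f. Here y (S(k) + S(k+1)) is y² g.
  expands-1 : ∀ {ss} (f S : ℕ → ℚ) → S 0 ≡ 0ℚ → (∀ k → S (suc k) - S k ≡ f k) →
    Expands ss f → Expands (1 ∷ ss) (λ k → odd⁻¹ k * (S k + S (suc k)))
  expands-1 f S S0 ΔS = expands-∷ 1 f g λ n → begin
    odd⁻¹ n ^ 1 * ∑ (suc n) (λ k → coeff n k * f k)
      ≡⟨ rescale-one (odd⁻¹ n) (odd n) (∑ (suc n) (λ k → coeff n k * f k)) (odd⁻¹*odd n) ⟩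
    odd⁻¹ n ^ 2 * (odd n * ∑ (suc n) (λ k → coeff n k * f k))
      ≡⟨ cong (λ z → odd⁻¹ n ^ 2 * (odd n * z)) (∑-cong (suc n) λ k → cong (coeff n k *_) (ΔS k)) ⟨
    odd⁻¹ n ^ 2 * (odd n * ∑ (suc n) (λ k → coeff n k * (S (suc k) - S k)))
      ≡⟨ cong (odd⁻¹ n ^ 2 *_) (abel n S S0) ⟨
    odd⁻¹ n ^ 2 * ∑ (suc n) (λ k → coeff n k * (odd k * (S k + S (suc k))))
      ≡⟨ cong (odd⁻¹ n ^ 2 *_) (∑-cong (suc n) λ k → cong (coeff n k *_)
           (cancel (odd⁻¹ k) (odd k) (S k + S (suc k)) (odd⁻¹*odd k))) ⟨
    odd⁻¹ n ^ 2 * ∑ (suc n) (λ k → coeff n k * (odd k * odd k * g k)) ∎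
    where
    open ≡-Reasoning
    g : ℕ → ℚ
    g k = odd⁻¹ k * (S k + S (suc k))
    rescale-one : ∀ q x A → q * x ≡ 1ℚ → q ^ 1 * A ≡ q ^ 2 * (x * A)
    rescale-one q x A qx = trans
      (trans (solve 2 (λ q A → q :* con 1ℚ :* A := con 1ℚ :* (q :* A)) refl q A) (cong (_* (q * A)) (sym qx)))
      (solve 3 (λ q x A → q :* x :* (q :* A) := q :* (q :* con 1ℚ) :* (x :* A)) refl q x A)
    cancel : ∀ q y s → q * y ≡ 1ℚ → y * y * (q * s) ≡ y * s
    cancel q y s qy = trans (solve 3 (λ q y s → y :* y :* (q :* s) := q :* y :* (y :* s)) refl q y s)
      (trans (cong (_* (y * s)) qy) (*-identityˡ (y * s)))

  sign : ℕ → ℚ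
  sign k = (- 1ℚ) ^ k

  -- Apply abel to S k = sign k * T k: the sign exchanges sums and differences of consecutive values.
  expands-3 : ∀ {ss} (f T : ℕ → ℚ) → T 0 ≡ 0ℚ → (∀ k → odd k * (T (suc k) - T k) ≡ sign k * f k) →
    Expands ss f → Expands (3 ∷ ss) (λ k → odd⁻¹ k ^ 2 * (sign k * (T k + T (suc k))))
  expands-3 f T T0 ΔT = expands-∷ 3 f g λ n → begin
    odd⁻¹ n ^ 3 * ∑ (suc n) (λ k → coeff n k * f k)
      ≡⟨ cong (odd⁻¹ n ^ 3 *_) (alternate n) ⟩
    odd⁻¹ n ^ 3 * (odd n * ∑ (suc n) (λ k → coeff n k * (sign k * (T k + T (suc k)))))
      ≡⟨ cancel (odd⁻¹ n) (odd n) (∑ (suc n) (λ k → coeff n k * (sign k * (T k + T (suc k))))) (odd⁻¹*odd n) ⟩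
    odd⁻¹ n ^ 2 * ∑ (suc n) (λ k → coeff n k * (sign k * (T k + T (suc k))))
      ≡⟨ cong (odd⁻¹ n ^ 2 *_) (∑-cong (suc n) λ k → cong (coeff n k *_)
           (odd²*odd⁻¹² k (sign k * (T k + T (suc k))))) ⟨
    odd⁻¹ n ^ 2 * ∑ (suc n) (λ k → coeff n k * (odd k * odd k * g k)) ∎
    where
    open ≡-Reasoning
    g S : ℕ → ℚ
    g k = odd⁻¹ k ^ 2 * (sign k * (T k + T (suc k)))
    S k = sign k * T k
    cancel : ∀ q x A → q * x ≡ 1ℚ → q ^ 3 * (x * A) ≡ q ^ 2 * A
    cancel q x A qx = trans
      (solve 3 (λ q x A → q :* (q :* (q :* con 1ℚ)) :* (x :* A) := q :* x :* (q :* (q :* con 1ℚ) :* A)) refl q x A)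
      (trans (cong (_* (q ^ 2 * A)) qx) (*-identityˡ (q ^ 2 * A)))
    sum-is-f : ∀ c y s t t′ f → s * s ≡ 1ℚ → y * (t′ - t) ≡ s * f →
      c * f ≡ - 1ℚ * (c * (y * (s * t + - 1ℚ * s * t′)))
    sum-is-f c y s t t′ f s² h = begin
      c * f
        ≡⟨ cong (c *_) (*-identityˡ f) ⟨
      c * (1ℚ * f)
        ≡⟨ cong (λ z → c * (z * f)) s² ⟨
      c * (s * s * f)
        ≡⟨ cong (c *_) (*-assoc s s f) ⟩
      c * (s * (s * f))
        ≡⟨ cong (λ z → c * (s * z)) h ⟨
      c * (s * (y * (t′ - t)))
        ≡⟨ solve 5 (λ c y s t t′ → c :* (s :* (y :* (t′ :- t)))
             := con (- 1ℚ) :* (c :* (y :* (s :* t :+ con (- 1ℚ) :* s :* t′)))) refl c y s t t′ ⟩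
      - 1ℚ * (c * (y * (s * t + - 1ℚ * s * t′))) ∎
    difference-is-sum : ∀ c s t t′ → - 1ℚ * (c * (- 1ℚ * s * t′ - s * t)) ≡ c * (s * (t + t′))
    difference-is-sum = solve 4 (λ c s t t′ → con (- 1ℚ) :* (c :* (con (- 1ℚ) :* s :* t′ :- s :* t))
      := c :* (s :* (t :+ t′))) refl
    swap : ∀ x A → - 1ℚ * (x * A) ≡ x * (- 1ℚ * A)
    swap = solve 2 (λ x A → con (- 1ℚ) :* (x :* A) := x :* (con (- 1ℚ) :* A)) refl
    alternate : ∀ n → ∑ (suc n) (λ k → coeff n k * f k) ≡ odd n * ∑ (suc n) (λ k → coeff n k * (sign k * (T k + T (suc k))))
    alternate n = begin
      ∑ (suc n) (λ k → coeff n k * f k)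
        ≡⟨ ∑-cong (suc n) (λ k → sum-is-f (coeff n k) (odd k) (sign k) (T k) (T (suc k)) (f k) ([-1]^n*[-1]^n k) (ΔT k)) ⟩
      ∑ (suc n) (λ k → - 1ℚ * (coeff n k * (odd k * (S k + S (suc k)))))
        ≡⟨ ∑-* (suc n) (- 1ℚ) (λ k → coeff n k * (odd k * (S k + S (suc k)))) ⟩
      - 1ℚ * ∑ (suc n) (λ k → coeff n k * (odd k * (S k + S (suc k))))
        ≡⟨ cong (- 1ℚ *_) (abel n S (trans (*-identityˡ (T 0)) T0)) ⟩
      - 1ℚ * (odd n * ∑ (suc n) (λ k → coeff n k * (S (suc k) - S k)))
        ≡⟨ swap (odd n) (∑ (suc n) (λ k → coeff n k * (S (suc k) - S k))) ⟩
      odd n * (- 1ℚ * ∑ (suc n) (λ k → coeff n k * (S (suc k) - S k)))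
        ≡⟨ cong (odd n *_) (∑-* (suc n) (- 1ℚ) (λ k → coeff n k * (S (suc k) - S k))) ⟨
      odd n * ∑ (suc n) (λ k → - 1ℚ * (coeff n k * (S (suc k) - S k)))
        ≡⟨ cong (odd n *_) (∑-cong (suc n) λ k → difference-is-sum (coeff n k) (sign k) (T k) (T (suc k))) ⟩
      odd n * ∑ (suc n) (λ k → coeff n k * (sign k * (T k + T (suc k)))) ∎

  -- The sum telescopes: its partial sums are multiples of the next coefficient. The factor 2(x-1)
  -- is kept on the left because it vanishes at n = 0.
  alternating-partial : ∀ n m →
    2ℚ * (odd n - 1ℚ) * ∑ m (λ k → coeff n k * (sign k * odd k))
    ≡ - (sign m * ((odd m - 1ℚ) * ((odd n + odd m) * coeff n m)))
  alternating-partial n zero =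
    solve 2 (λ x w → con 2ℚ :* (x :- con 1ℚ) :* con 0ℚ
      := :- (con 1ℚ :* ((con 1ℚ :- con 1ℚ) :* ((x :+ con 1ℚ) :* w)))) refl (odd n) (wallis n)
  alternating-partial n (suc m) =
    step (odd n) (odd m) (odd (suc m)) (coeff n m) (coeff n (suc m)) (sign m)
      (∑ m (λ k → coeff n k * (sign k * odd k))) (odd-suc m) (coeff-suc n m) (alternating-partial n m)
    where
    open ≡-Reasoning
    step : ∀ x y y′ c c′ s P → y′ ≡ y + 2ℚ → (x + y′) * c′ ≡ (x - y) * c →
      2ℚ * (x - 1ℚ) * P ≡ - (s * ((y - 1ℚ) * ((x + y) * c))) →
      2ℚ * (x - 1ℚ) * (P + c * (s * y)) ≡ - ((- 1ℚ * s) * ((y′ - 1ℚ) * ((x + y′) * c′)))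
    step x y y′ c c′ s P refl h ih = begin
      2ℚ * (x - 1ℚ) * (P + c * (s * y))
        ≡⟨ *-distribˡ-+ (2ℚ * (x - 1ℚ)) P (c * (s * y)) ⟩
      2ℚ * (x - 1ℚ) * P + 2ℚ * (x - 1ℚ) * (c * (s * y))
        ≡⟨ cong (_+ 2ℚ * (x - 1ℚ) * (c * (s * y))) ih ⟩
      - (s * ((y - 1ℚ) * ((x + y) * c))) + 2ℚ * (x - 1ℚ) * (c * (s * y))
        ≡⟨ solve 4 (λ x y c s → :- (s :* ((y :- con 1ℚ) :* ((x :+ y) :* c))) :+ con 2ℚ :* (x :- con 1ℚ) :* (c :* (s :* y))
             := :- ((con (- 1ℚ) :* s) :* ((y :+ con 2ℚ :- con 1ℚ) :* ((x :- y) :* c)))) refl x y c s ⟩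
      - ((- 1ℚ * s) * ((y + 2ℚ - 1ℚ) * ((x - y) * c)))
        ≡⟨ cong (λ z → - ((- 1ℚ * s) * ((y + 2ℚ - 1ℚ) * z))) h ⟨
      - ((- 1ℚ * s) * ((y + 2ℚ - 1ℚ) * ((x + (y + 2ℚ)) * c′))) ∎

  -- The right side of `alternating-partial` ends in a coefficient beyond the row. The row index is
  -- `suc n` so that 2(x-1) can be cancelled; in row 0 the sum is 1.
  alternating-vanishes : ∀ n → ∑ (suc (suc n)) (λ k → coeff (suc n) k * (sign k * odd k)) ≡ 0ℚ
  alternating-vanishes n = divide (odd n) (odd (suc n)) A (sign (suc (suc n))) (odd (suc (suc n)) - 1ℚ)
    (odd (suc n) + odd (suc (suc n))) (coeff (suc n) (suc (suc n)))
    (0<1+odd n) (odd-suc n) (coeff-end (suc n)) (alternating-partial (suc n) (suc (suc n)))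
    where
    A = ∑ (suc (suc n)) (λ k → coeff (suc n) k * (sign k * odd k))
    divide : ∀ x x′ A s d e c → 0ℚ < x + 1ℚ → x′ ≡ x + 2ℚ → c ≡ 0ℚ →
      2ℚ * (x′ - 1ℚ) * A ≡ - (s * (d * (e * c))) → A ≡ 0ℚ
    divide x x′ A s d e c 0<x+1 refl refl h = *-cancelʳ-pos A 0ℚ (2ℚ * (x + 1ℚ)) (0<* (positive⁻¹ 2ℚ) 0<x+1)
      (trans (solve 2 (λ x A → A :* (con 2ℚ :* (x :+ con 1ℚ)) := con 2ℚ :* (x :+ con 2ℚ :- con 1ℚ) :* A) refl x A)
        (trans h (solve 4 (λ s d e x → :- (s :* (d :* (e :* con 0ℚ))) := con 0ℚ :* (con 2ℚ :* (x :+ con 1ℚ))) refl s d e x)))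

  -- The partial fraction expansion at z = 0. Passing to the next row changes the sum by a multiple
  -- of the alternating sum of c(n+1,k) y, which is zero.
  one-expansion : ∀ n → ∑ (suc n) (λ k → coeff n k * (sign k * odd⁻¹ k)) ≡ 1ℚ
  one-expansion zero    = refl
  one-expansion (suc n) = begin
    ∑ (suc (suc n)) (λ k → coeff (suc n) k * (sign k * odd⁻¹ k))
      ≡⟨ expansion-suc (λ k → sign k * odd⁻¹ k) n ⟩
    A + q² * ∑ (suc (suc n)) (λ k → coeff (suc n) k * (odd k * odd k * (sign k * odd⁻¹ k)))
      ≡⟨ cong₂ (λ u v → u + q² * v) (one-expansion n)
           (trans (∑-cong (suc (suc n)) λ k → cong (coeff (suc n) k *_)
             (cancel (odd⁻¹ k) (odd k) (sign k) (odd⁻¹*odd k))) (alternating-vanishes n)) ⟩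
    1ℚ + q² * 0ℚ
      ≡⟨ cong (λ z → 1ℚ + z) (*-zeroʳ q²) ⟩
    1ℚ ∎
    where
    open ≡-Reasoning
    q² = odd⁻¹ (suc n) ^ 2
    A = ∑ (suc n) (λ k → coeff n k * (sign k * odd⁻¹ k))
    cancel : ∀ q y s → q * y ≡ 1ℚ → y * y * (s * q) ≡ s * y
    cancel q y s qy = trans (solve 3 (λ q y s → y :* y :* (s :* q) := q :* y :* (s :* y)) refl q y s)
      (trans (cong (_* (s * y)) qy) (*-identityˡ (s * y)))

  expands-[] : Expands [] (λ k → sign k * odd⁻¹ k)
  expands-[] = expands λ n → sym (one-expansion n)

  expands-twos-[] : ∀ c → Expands (twos c) (λ k → odd⁻¹ k ^ (2 ℕ.* c) * (sign k * odd⁻¹ k))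
  expands-twos-[] c = subst (λ ss → Expands ss (λ k → odd⁻¹ k ^ (2 ℕ.* c) * (sign k * odd⁻¹ k)))
    (++-identityʳ (twos c)) (expands-twos c (λ k → sign k * odd⁻¹ k) expands-[])

  -- Expansions in terms of alternating sums

  [+1]^n : ∀ n → sgn Sign.+ ^ n ≡ 1ℚ
  [+1]^n zero    = refl
  [+1]^n (suc n) = trans (*-identityˡ (sgn Sign.+ ^ n)) ([+1]^n n)

  Δ : (ℕ → ℚ) → ℕ → ℚ
  Δ F k = F (suc k) - F k

  -- π/4 times the value of a star sum whose index is the given one without its first block of twos
  -- and the following 1. The minus signs arise because a barred letter carries (-1)^(k+1) at
  -- position k, counted from 0.
  twoTerms : List Letter → List Letter → ℕ → ℚ
  twoTerms u v n = - tSum n u - 2ℚ * tSum n v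

  -- π/4 times the claimed right-hand side: the numerators 4, 8, 8, 16 divided by 4.
  fourTerms : List Letter → List Letter → List Letter → List Letter → ℕ → ℚ
  fourTerms u v w z n = - tSum n u - 2ℚ * tSum n v - 2ℚ * tSum n w - 4ℚ * tSum n z

  -- Write S(k) + S(k+1) as 2 S(k) plus the increment of S at k. In the increment the new factor
  -- q^(2a+1) merges with the first letter of each term, raising its exponent; in 2 S(k) it becomes
  -- a new leading letter 2a+1 followed by strictly smaller summation indices. Thus two terms become
  -- four and the coefficient 2 becomes 4. The exponents `e₁` and `e₃` are passed with equations to
  -- allow the bracketing of the final statement.
  expands-twos-1 : ∀ a {ss p r e₁ e₃} σ τ ps → e₁ ≡ 2 ℕ.* a ℕ.+ (1 ℕ.+ p) → e₃ ≡ 2 ℕ.* a ℕ.+ (1 ℕ.+ r) →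
    Expands ss (Δ (twoTerms ((p , σ) ∷ []) ((r , τ) ∷ ps))) →
    Expands (twos a ++ 1 ∷ ss)
      (Δ (fourTerms ((e₁ , σ) ∷ []) (plain (2 ℕ.* a ℕ.+ 1) ∷ (p , σ) ∷ [])
                    ((e₃ , τ) ∷ ps) (plain (2 ℕ.* a ℕ.+ 1) ∷ (r , τ) ∷ ps)))
  expands-twos-1 a {ss} {p} {r} {_} {_} σ τ ps refl refl e =
    expands-cong regroup (expands-twos a (λ k → odd⁻¹ k * (S k + S (suc k))) (expands-1 (Δ S) S refl (λ k → refl) e))
    where
    S = twoTerms ((p , σ) ∷ []) ((r , τ) ∷ ps)
    H = fourTerms ((2 ℕ.* a ℕ.+ (1 ℕ.+ p) , σ) ∷ []) (plain (2 ℕ.* a ℕ.+ 1) ∷ (p , σ) ∷ [])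
                  ((2 ℕ.* a ℕ.+ (1 ℕ.+ r) , τ) ∷ ps) (plain (2 ℕ.* a ℕ.+ 1) ∷ (r , τ) ∷ ps)
    combine : ∀ A q g h o P R P₁ P₂ P₃ u v T h₁ h₂ h₃ h₄ →
      P₁ ≡ A * (q * P) → P₂ ≡ A * (q * 1ℚ) → P₃ ≡ A * (q * R) → o ≡ 1ℚ →
      A * (q * ((- u - 2ℚ * v) + (- (u + (g * P) * 1ℚ) - 2ℚ * (v + (h * R) * T))))
      ≡ (- (h₁ + (g * P₁) * 1ℚ) - 2ℚ * (h₂ + (o * P₂) * u) - 2ℚ * (h₃ + (h * P₃) * T) - 4ℚ * (h₄ + (o * P₂) * v))
        - (- h₁ - 2ℚ * h₂ - 2ℚ * h₃ - 4ℚ * h₄)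
    combine A q g h _ P R _ _ _ u v T h₁ h₂ h₃ h₄ refl refl refl refl =
      solve 13 (λ A q g h P R u v T h₁ h₂ h₃ h₄ →
        A :* (q :* ((:- u :- con 2ℚ :* v) :+ (:- (u :+ (g :* P) :* con 1ℚ) :- con 2ℚ :* (v :+ (h :* R) :* T))))
        := (:- (h₁ :+ (g :* (A :* (q :* P))) :* con 1ℚ) :- con 2ℚ :* (h₂ :+ (con 1ℚ :* (A :* (q :* con 1ℚ))) :* u)
             :- con 2ℚ :* (h₃ :+ (h :* (A :* (q :* R))) :* T) :- con 4ℚ :* (h₄ :+ (con 1ℚ :* (A :* (q :* con 1ℚ))) :* v))
           :- (:- h₁ :- con 2ℚ :* h₂ :- con 2ℚ :* h₃ :- con 4ℚ :* h₄)) refl A q g h P R u v T h₁ h₂ h₃ h₄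
    regroup : ∀ k → odd⁻¹ k ^ (2 ℕ.* a) * (odd⁻¹ k * (S k + S (suc k))) ≡ Δ H k
    regroup k = combine (q ^ (2 ℕ.* a)) q (sgn σ ^ suc k) (sgn τ ^ suc k) (sgn Sign.+ ^ suc k)
      (q ^ p) (q ^ r) (q ^ (2 ℕ.* a ℕ.+ (1 ℕ.+ p))) (q ^ (2 ℕ.* a ℕ.+ 1)) (q ^ (2 ℕ.* a ℕ.+ (1 ℕ.+ r)))
      (tSum k ((p , σ) ∷ [])) (tSum k ((r , τ) ∷ ps)) (tSum k ps)
      (tSum k ((2 ℕ.* a ℕ.+ (1 ℕ.+ p) , σ) ∷ [])) (tSum k (plain (2 ℕ.* a ℕ.+ 1) ∷ (p , σ) ∷ []))
      (tSum k ((2 ℕ.* a ℕ.+ (1 ℕ.+ r) , τ) ∷ ps)) (tSum k (plain (2 ℕ.* a ℕ.+ 1) ∷ (r , τ) ∷ ps))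
      (^-homo-* q (2 ℕ.* a) (1 ℕ.+ p)) (^-homo-* q (2 ℕ.* a) 1) (^-homo-* q (2 ℕ.* a) (1 ℕ.+ r)) ([+1]^n (suc k))
      where q = odd⁻¹ k

  expands-twos-3 : ∀ b c →
    Expands (twos b ++ 3 ∷ twos c)
      (Δ (twoTerms (bar (2 ℕ.* b ℕ.+ 2 ℕ.* c ℕ.+ 4) ∷ []) (bar (2 ℕ.* b ℕ.+ 2) ∷ plain (2 ℕ.* c ℕ.+ 2) ∷ [])))
  expands-twos-3 b c = expands-cong regroup
    (expands-twos b (λ k → odd⁻¹ k ^ 2 * (sign k * (T k + T (suc k))))
      (expands-3 f T refl ΔT (expands-twos-[] c)))
    where
    f T S : ℕ → ℚ
    f k = odd⁻¹ k ^ (2 ℕ.* c) * (sign k * odd⁻¹ k)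
    -- The sign in f cancels against the one required by `expands-3`, so T is a sum without
    -- alternation; its exponent exceeds that of f by one because of the division by y.
    T n = tSum n (plain (2 ℕ.* c ℕ.+ 2) ∷ [])
    S = twoTerms (bar (2 ℕ.* b ℕ.+ 2 ℕ.* c ℕ.+ 4) ∷ []) (bar (2 ℕ.* b ℕ.+ 2) ∷ plain (2 ℕ.* c ℕ.+ 2) ∷ [])
    cancel : ∀ q y s C P t o → q * y ≡ 1ℚ → s * s ≡ 1ℚ → o ≡ 1ℚ → P ≡ C * q ^ 2 →
      y * ((t + (o * P) * 1ℚ) - t) ≡ s * (C * (s * q))
    cancel q y s C _ t _ qy s² refl refl = trans
      (solve 4 (λ q y C t → y :* ((t :+ (con 1ℚ :* (C :* (q :* (q :* con 1ℚ)))) :* con 1ℚ) :- t) := q :* y :* (C :* q)) refl q y C t)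
      (trans (cong (_* (C * q)) (trans qy (sym s²)))
        (solve 3 (λ q s C → s :* s :* (C :* q) := s :* (C :* (s :* q))) refl q s C))
    ΔT : ∀ k → odd k * (T (suc k) - T k) ≡ sign k * f k
    ΔT k = cancel (odd⁻¹ k) (odd k) (sign k) (odd⁻¹ k ^ (2 ℕ.* c)) (odd⁻¹ k ^ (2 ℕ.* c ℕ.+ 2)) (T k) (sgn Sign.+ ^ suc k)
      (odd⁻¹*odd k) ([-1]^n*[-1]^n k) ([+1]^n (suc k)) (^-homo-* (odd⁻¹ k) (2 ℕ.* c) 2)
    combine : ∀ B Q s t o P P₁ P₂ u v → P₁ ≡ B * (Q * P) → P₂ ≡ B * Q → o ≡ 1ℚ →
      B * (Q * (s * (t + (t + (o * P) * 1ℚ))))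
      ≡ (- (u + (- 1ℚ * s * P₁) * 1ℚ) - 2ℚ * (v + (- 1ℚ * s * P₂) * t)) - (- u - 2ℚ * v)
    combine B Q s t _ P _ _ u v refl refl refl =
      solve 7 (λ B Q s t P u v → B :* (Q :* (s :* (t :+ (t :+ (con 1ℚ :* P) :* con 1ℚ))))
        := (:- (u :+ (con (- 1ℚ) :* s :* (B :* (Q :* P))) :* con 1ℚ) :- con 2ℚ :* (v :+ (con (- 1ℚ) :* s :* (B :* Q)) :* t))
           :- (:- u :- con 2ℚ :* v)) refl B Q s t P u v
    exponent : 2 ℕ.* b ℕ.+ 2 ℕ.* c ℕ.+ 4 ≡ 2 ℕ.* b ℕ.+ (2 ℕ.+ (2 ℕ.* c ℕ.+ 2))
    exponent = solveℕ 2 (λ b c → b :+ℕ c :+ℕ conℕ 4 :=ℕ b :+ℕ (conℕ 2 :+ℕ (c :+ℕ conℕ 2))) refl (2 ℕ.* b) (2 ℕ.* c)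
    regroup : ∀ k → odd⁻¹ k ^ (2 ℕ.* b) * (odd⁻¹ k ^ 2 * (sign k * (T k + T (suc k)))) ≡ Δ S k
    regroup k = combine (q ^ (2 ℕ.* b)) (q ^ 2) (sign k) (T k) (sgn Sign.+ ^ suc k)
      (q ^ (2 ℕ.* c ℕ.+ 2)) (q ^ (2 ℕ.* b ℕ.+ 2 ℕ.* c ℕ.+ 4)) (q ^ (2 ℕ.* b ℕ.+ 2))
      (tSum k (bar (2 ℕ.* b ℕ.+ 2 ℕ.* c ℕ.+ 4) ∷ [])) (tSum k (bar (2 ℕ.* b ℕ.+ 2) ∷ plain (2 ℕ.* c ℕ.+ 2) ∷ []))
      (trans (cong (q ^_) exponent) (trans (^-homo-* q (2 ℕ.* b) (2 ℕ.+ (2 ℕ.* c ℕ.+ 2)))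
        (cong (q ^ (2 ℕ.* b) *_) (^-homo-* q 2 (2 ℕ.* c ℕ.+ 2)))))
      (^-homo-* q (2 ℕ.* b) 2) ([+1]^n (suc k))
      where q = odd⁻¹ k

  expands-twos-1-twos : ∀ b c →
    Expands (twos b ++ 1 ∷ twos c)
      (Δ (twoTerms (bar (2 ℕ.* b ℕ.+ 2 ℕ.* c ℕ.+ 2) ∷ []) (plain (2 ℕ.* b ℕ.+ 1) ∷ bar (2 ℕ.* c ℕ.+ 1) ∷ [])))
  expands-twos-1-twos b c = expands-cong regroup
    (expands-twos b (λ k → odd⁻¹ k * (S₀ k + S₀ (suc k))) (expands-1 f S₀ refl ΔS₀ (expands-twos-[] c)))
    where
    f T S₀ S : ℕ → ℚ
    f k = odd⁻¹ k ^ (2 ℕ.* c) * (sign k * odd⁻¹ k)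
    T n = tSum n (bar (2 ℕ.* c ℕ.+ 1) ∷ [])
    -- A barred letter at position k has sign (-1)^(k+1), opposite to that of f.
    S₀ n = - T n
    S = twoTerms (bar (2 ℕ.* b ℕ.+ 2 ℕ.* c ℕ.+ 2) ∷ []) (plain (2 ℕ.* b ℕ.+ 1) ∷ bar (2 ℕ.* c ℕ.+ 1) ∷ [])
    difference : ∀ q s C P t → P ≡ C * (q * 1ℚ) → - (t + (- 1ℚ * s * P) * 1ℚ) - - t ≡ C * (s * q)
    difference q s C _ t refl = solve 4 (λ q s C t →
      :- (t :+ (con (- 1ℚ) :* s :* (C :* (q :* con 1ℚ))) :* con 1ℚ) :- (:- t) := C :* (s :* q)) refl q s C t
    ΔS₀ : ∀ k → S₀ (suc k) - S₀ k ≡ f k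
    ΔS₀ k = difference (odd⁻¹ k) (sign k) (odd⁻¹ k ^ (2 ℕ.* c)) (odd⁻¹ k ^ (2 ℕ.* c ℕ.+ 1)) (T k)
      (^-homo-* (odd⁻¹ k) (2 ℕ.* c) 1)
    combine : ∀ B q s t o P P₁ P₂ u v → P₁ ≡ B * (q * P) → P₂ ≡ B * (q * 1ℚ) → o ≡ 1ℚ →
      B * (q * (- t + - (t + (- 1ℚ * s * P) * 1ℚ)))
      ≡ (- (u + (- 1ℚ * s * P₁) * 1ℚ) - 2ℚ * (v + (o * P₂) * t)) - (- u - 2ℚ * v)
    combine B q s t _ P _ _ u v refl refl refl =
      solve 7 (λ B q s t P u v → B :* (q :* (:- t :+ :- (t :+ (con (- 1ℚ) :* s :* P) :* con 1ℚ)))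
        := (:- (u :+ (con (- 1ℚ) :* s :* (B :* (q :* P))) :* con 1ℚ) :- con 2ℚ :* (v :+ (con 1ℚ :* (B :* (q :* con 1ℚ))) :* t))
           :- (:- u :- con 2ℚ :* v)) refl B q s t P u v
    exponent : 2 ℕ.* b ℕ.+ 2 ℕ.* c ℕ.+ 2 ≡ 2 ℕ.* b ℕ.+ (1 ℕ.+ (2 ℕ.* c ℕ.+ 1))
    exponent = solveℕ 2 (λ b c → b :+ℕ c :+ℕ conℕ 2 :=ℕ b :+ℕ (conℕ 1 :+ℕ (c :+ℕ conℕ 1))) refl (2 ℕ.* b) (2 ℕ.* c)
    regroup : ∀ k → odd⁻¹ k ^ (2 ℕ.* b) * (odd⁻¹ k * (S₀ k + S₀ (suc k))) ≡ Δ S k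
    regroup k = combine (q ^ (2 ℕ.* b)) q (sign k) (T k) (sgn Sign.+ ^ suc k)
      (q ^ (2 ℕ.* c ℕ.+ 1)) (q ^ (2 ℕ.* b ℕ.+ 2 ℕ.* c ℕ.+ 2)) (q ^ (2 ℕ.* b ℕ.+ 1))
      (tSum k (bar (2 ℕ.* b ℕ.+ 2 ℕ.* c ℕ.+ 2) ∷ [])) (tSum k (plain (2 ℕ.* b ℕ.+ 1) ∷ bar (2 ℕ.* c ℕ.+ 1) ∷ []))
      (trans (cong (q ^_) exponent) (^-homo-* q (2 ℕ.* b) (1 ℕ.+ (2 ℕ.* c ℕ.+ 1))))
      (^-homo-* q (2 ℕ.* b) 1) ([+1]^n (suc k))
      where q = odd⁻¹ k

  expands-1-3 : ∀ a b c → Expands (twos a ++ 1 ∷ twos b ++ 3 ∷ twos c)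
    (Δ (fourTerms
      (bar (2 ℕ.* a ℕ.+ 2 ℕ.* b ℕ.+ 2 ℕ.* c ℕ.+ 5) ∷ [])
      (plain (2 ℕ.* a ℕ.+ 1) ∷ bar (2 ℕ.* b ℕ.+ 2 ℕ.* c ℕ.+ 4) ∷ [])
      (bar (2 ℕ.* a ℕ.+ 2 ℕ.* b ℕ.+ 3) ∷ plain (2 ℕ.* c ℕ.+ 2) ∷ [])
      (plain (2 ℕ.* a ℕ.+ 1) ∷ bar (2 ℕ.* b ℕ.+ 2) ∷ plain (2 ℕ.* c ℕ.+ 2) ∷ [])))
  expands-1-3 a b c = expands-twos-1 a Sign.- Sign.- (plain (2 ℕ.* c ℕ.+ 2) ∷ [])
    (solveℕ 3 (λ a b c → a :+ℕ b :+ℕ c :+ℕ conℕ 5 :=ℕ a :+ℕ (conℕ 1 :+ℕ (b :+ℕ c :+ℕ conℕ 4))) refl (2 ℕ.* a) (2 ℕ.* b) (2 ℕ.* c))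
    (solveℕ 2 (λ a b → a :+ℕ b :+ℕ conℕ 3 :=ℕ a :+ℕ (conℕ 1 :+ℕ (b :+ℕ conℕ 2))) refl (2 ℕ.* a) (2 ℕ.* b))
    (expands-twos-3 b c)

  expands-1-1 : ∀ a b c → Expands (twos a ++ 1 ∷ twos b ++ 1 ∷ twos c)
    (Δ (fourTerms
      (bar (2 ℕ.* a ℕ.+ 2 ℕ.* b ℕ.+ 2 ℕ.* c ℕ.+ 3) ∷ [])
      (plain (2 ℕ.* a ℕ.+ 1) ∷ bar (2 ℕ.* b ℕ.+ 2 ℕ.* c ℕ.+ 2) ∷ [])
      (plain (2 ℕ.* a ℕ.+ 2 ℕ.* b ℕ.+ 2) ∷ bar (2 ℕ.* c ℕ.+ 1) ∷ [])
      (plain (2 ℕ.* a ℕ.+ 1) ∷ plain (2 ℕ.* b ℕ.+ 1) ∷ bar (2 ℕ.* c ℕ.+ 1) ∷ [])))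
  expands-1-1 a b c = expands-twos-1 a Sign.- Sign.+ (bar (2 ℕ.* c ℕ.+ 1) ∷ [])
    (solveℕ 3 (λ a b c → a :+ℕ b :+ℕ c :+ℕ conℕ 3 :=ℕ a :+ℕ (conℕ 1 :+ℕ (b :+ℕ c :+ℕ conℕ 2))) refl (2 ℕ.* a) (2 ℕ.* b) (2 ℕ.* c))
    (solveℕ 2 (λ a b → a :+ℕ b :+ℕ conℕ 2 :=ℕ a :+ℕ (conℕ 1 :+ℕ (b :+ℕ conℕ 1))) refl (2 ℕ.* a) (2 ℕ.* b))
    (expands-twos-1-twos b c)

  -- Passing to the limit

  ∑-nonneg : ∀ m {f : ℕ → ℚ} → (∀ k → 0ℚ ≤ f k) → 0ℚ ≤ ∑ m f
  ∑-nonneg zero        h = ≤-refl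
  ∑-nonneg (suc m) {f} h = 0≤+ {∑ m f} {f m} (∑-nonneg m h) (h m)

  ∑-mono : ∀ m {f g : ℕ → ℚ} → (∀ k → f k ≤ g k) → ∑ m f ≤ ∑ m g
  ∑-mono zero    h = ≤-refl
  ∑-mono (suc m) h = +-mono-≤ (∑-mono m h) (h m)

  gap : ℕ → ℕ → ℚ
  gap n k = coeff n k - coeff n (suc k)

  -- The recursion `coeff-suc`, solved for x (c(n,k) - c(n,k+1)). It shows both that the gaps are
  -- nonnegative and that they are of order 1/x for fixed k.
  gap-eq : ∀ n k → gap n k ≡ odd⁻¹ n * (odd k * coeff n k + odd (suc k) * coeff n (suc k))
  gap-eq n k = divide (odd⁻¹ n) (odd n) (odd k) (odd (suc k)) (coeff n k) (coeff n (suc k))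
    (odd⁻¹*odd n) (coeff-suc n k)
    where
    open ≡-Reasoning
    divide : ∀ q x y y′ c c′ → q * x ≡ 1ℚ → (x + y′) * c′ ≡ (x - y) * c → c - c′ ≡ q * (y * c + y′ * c′)
    divide q x y y′ c c′ qx h = begin
      c - c′
        ≡⟨ *-identityˡ (c - c′) ⟨
      1ℚ * (c - c′)
        ≡⟨ cong (_* (c - c′)) qx ⟨
      q * x * (c - c′)
        ≡⟨ solve 5 (λ q x y c c′ → q :* x :* (c :- c′) := q :* (y :* c :+ (x :- y) :* c :- x :* c′)) refl q x y c c′ ⟩
      q * (y * c + (x - y) * c - x * c′)
        ≡⟨ cong (λ z → q * (y * c + z - x * c′)) h ⟨
      q * (y * c + (x + y′) * c′ - x * c′)
        ≡⟨ solve 6 (λ q x y y′ c c′ → q :* (y :* c :+ (x :+ y′) :* c′ :- x :* c′) := q :* (y :* c :+ y′ :* c′)) refl q x y y′ c c′ ⟩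
      q * (y * c + y′ * c′) ∎

  0≤gap : ∀ n k → 0ℚ ≤ gap n k
  0≤gap n k = subst (0ℚ ≤_) (sym (gap-eq n k))
    (0≤* {odd⁻¹ n} {odd k * coeff n k + odd (suc k) * coeff n (suc k)} (0≤odd⁻¹ n)
      (0≤+ {odd k * coeff n k} {odd (suc k) * coeff n (suc k)}
        (0≤* {odd k} {coeff n k} (0≤odd k) (0≤coeff n k))
        (0≤* {odd (suc k)} {coeff n (suc k)} (0≤odd (suc k)) (0≤coeff n (suc k)))))

  coeff≤wallis : ∀ n k → coeff n k ≤ wallis n
  coeff≤wallis n zero    = ≤-refl
  coeff≤wallis n (suc k) = ≤-trans {coeff n (suc k)} {coeff n k} {wallis n}
    (0≤-⇒≤ {coeff n (suc k)} {coeff n k} (0≤gap n k)) (coeff≤wallis n k)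

  ∑-gap : ∀ n m → ∑ m (gap n) ≡ wallis n - coeff n m
  ∑-gap n zero    = sym (+-inverseʳ (wallis n))
  ∑-gap n (suc m) = trans (cong (_+ gap n m) (∑-gap n m))
    (telescope (wallis n) (coeff n m) (coeff n (suc m)))
    where
    telescope : ∀ w c c′ → (w - c) + (c - c′) ≡ w - c′
    telescope = solve 3 (λ w c c′ → (w :- c) :+ (c :- c′) := w :- c′) refl

  ∑-gap≤wallis : ∀ n m → ∑ m (gap n) ≤ wallis n
  ∑-gap≤wallis n m = subst (_≤ wallis n) (sym (∑-gap n m)) (-‿mono {wallis n} {coeff n m} (0≤coeff n m))

  -- Summation by parts for H - l in place of H. The constant l is free: a lower bound of H yields
  -- an estimate of `wallis`, and a late value of H yields the Toeplitz limit.
  abel-gap-partial : ∀ n (H : ℕ → ℚ) l → H 0 ≡ 0ℚ → ∀ m →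
    ∑ m (λ k → coeff n k * Δ H k)
    ≡ ∑ m (λ k → gap n k * (H (suc k) - l)) + wallis n * l + coeff n m * (H m - l)
  abel-gap-partial n H l H0 zero = trans
    (solve 2 (λ w l → con 0ℚ := con 0ℚ :+ w :* l :+ w :* (con 0ℚ :- l)) refl (wallis n) l)
    (cong (λ h → 0ℚ + wallis n * l + wallis n * (h - l)) (sym H0))
  abel-gap-partial n H l H0 (suc m) = step (∑ m (λ k → coeff n k * Δ H k))
    (∑ m (λ k → gap n k * (H (suc k) - l))) (wallis n) l (coeff n m) (coeff n (suc m)) (H m) (H (suc m))
    (abel-gap-partial n H l H0 m)
    where
    step : ∀ P Q w l c c′ h h′ → P ≡ Q + w * l + c * (h - l) →
      P + c * (h′ - h) ≡ (Q + (c - c′) * (h′ - l)) + w * l + c′ * (h′ - l)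
    step _ Q w l c c′ h h′ refl = solve 7 (λ Q w l c c′ h h′ →
      (Q :+ w :* l :+ c :* (h :- l)) :+ c :* (h′ :- h)
      := (Q :+ (c :- c′) :* (h′ :- l)) :+ w :* l :+ c′ :* (h′ :- l)) refl Q w l c c′ h h′

  abel-gap : ∀ n (H : ℕ → ℚ) l → H 0 ≡ 0ℚ →
    ∑ (suc n) (λ k → coeff n k * Δ H k) ≡ ∑ (suc n) (λ k → gap n k * (H (suc k) - l)) + wallis n * l
  abel-gap n H l H0 = trans (abel-gap-partial n H l H0 (suc n))
    (drop (∑ (suc n) (λ k → gap n k * (H (suc k) - l)) + wallis n * l) (coeff n (suc n)) (H (suc n) - l) (coeff-end n))
    where
    drop : ∀ p c s → c ≡ 0ℚ → p + c * s ≡ p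
    drop p _ s refl = solve 2 (λ p s → p :+ con 0ℚ :* s := p) refl p s

  leibniz-expansion : ∀ n → ∑ (suc n) (λ k → coeff n k * Δ leibnizSum k) ≡ 1ℚ
  leibniz-expansion n = trans
    (∑-cong (suc n) λ k → cong (coeff n k *_) (add-sub (leibnizSum k) (sign k * odd⁻¹ k)))
    (one-expansion n)

  ⅔ : ℚ
  ⅔ = + 2 / 3

  ⅔≤leibniz : ∀ n → ⅔ ≤ leibnizSum (suc n)
  ⅔≤leibniz n = *-cancelˡ-≤-pos {⅔} {leibnizSum (suc n)} 4ℚ
    (proj₂ (proj₂ (proj₂ π-positive)) (suc n) (s≤s z≤n))

  -- Take Leibniz's sums for H and l = 2/3. The averages of H - l are nonnegative and the total is
  -- 1, hence `wallis n` is at most 3/2.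
  wallis≤2 : ∀ n → wallis n ≤ 2ℚ
  wallis≤2 n = ≤-trans {wallis n} {3ℚ * ½} {2ℚ} (*-cancelʳ-≤-pos {wallis n} {3ℚ * ½} ⅔ (begin
    wallis n * ⅔
      ≡⟨ +-identityˡ (wallis n * ⅔) ⟨
    0ℚ + wallis n * ⅔
      ≤⟨ +-monoˡ-≤ (wallis n * ⅔) (∑-nonneg (suc n) λ k → 0≤* {gap n k} {leibnizSum (suc k) - ⅔}
           (0≤gap n k) (≤⇒0≤- {⅔} {leibnizSum (suc k)} (⅔≤leibniz k))) ⟩
    ∑ (suc n) (λ k → gap n k * (leibnizSum (suc k) - ⅔)) + wallis n * ⅔
      ≡⟨ abel-gap n leibnizSum ⅔ refl ⟨
    ∑ (suc n) (λ k → coeff n k * Δ leibnizSum k)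
      ≡⟨ leibniz-expansion n ⟩
    1ℚ ∎)) (*≤* (+≤+ (ℕ.m≤m+n 3 1)))
    where open ≤-Reasoning

  gap≤ : ∀ n k → gap n k ≤ odd⁻¹ n * (4ℚ * odd (suc k))
  gap≤ n k = subst (_≤ odd⁻¹ n * (4ℚ * odd (suc k))) (sym (gap-eq n k))
    (*-mono-nonNeg {odd k * coeff n k + odd (suc k) * coeff n (suc k)} {4ℚ * odd (suc k)} {odd⁻¹ n} (0≤odd⁻¹ n)
      (≤-trans {odd k * coeff n k + odd (suc k) * coeff n (suc k)} {odd (suc k) * 2ℚ + odd (suc k) * 2ℚ} {4ℚ * odd (suc k)}
        (+-mono-≤ {odd k * coeff n k} {odd (suc k) * 2ℚ} {odd (suc k) * coeff n (suc k)} {odd (suc k) * 2ℚ}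
          (*-mono₂ {odd k} {odd (suc k)} {coeff n k} {2ℚ} (0≤odd k) (*≤* (+≤+ z≤n)) (odd-mono (ℕ.n≤1+n k)) (coeff≤2 k))
          (*-mono-nonNeg {coeff n (suc k)} {2ℚ} {odd (suc k)} (0≤odd (suc k)) (coeff≤2 (suc k))))
        (≤-reflexive (double (odd (suc k))))))
    where
    coeff≤2 : ∀ j → coeff n j ≤ 2ℚ
    coeff≤2 j = ≤-trans {coeff n j} {wallis n} {2ℚ} (coeff≤wallis n j) (wallis≤2 n)
    double : ∀ y → y * 2ℚ + y * 2ℚ ≡ 4ℚ * y
    double = solve 1 (λ y → y :* con 2ℚ :+ y :* con 2ℚ := con 4ℚ :* y) refl

  -- Split the sum at N: the crude bound B serves the terms before N, the small bound ε those from N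
  -- on.
  ∣∑∣≤ : ∀ (g e : ℕ → ℚ) N B ε → (∀ k → 0ℚ ≤ g k) → 0ℚ ≤ ε →
    (∀ k → ∣ e k ∣ ≤ B) → (∀ k → N ℕ.≤ k → ∣ e k ∣ ≤ ε) →
    ∀ j → ∣ ∑ (j ℕ.+ N) (λ k → g k * e k) ∣ ≤ B * ∑ N g + ε * ∑ (j ℕ.+ N) g
  ∣∑∣≤ g e N B ε 0≤g 0≤ε e≤B e≤ε = go
    where
    open ≤-Reasoning
    term : ∀ k C → ∣ e k ∣ ≤ C → ∣ g k * e k ∣ ≤ C * g k
    term k C h = begin
      ∣ g k * e k ∣      ≡⟨ ∣p*q∣≡∣p∣*∣q∣ (g k) (e k) ⟩
      ∣ g k ∣ * ∣ e k ∣  ≡⟨ cong (_* ∣ e k ∣) (0≤p⇒∣p∣≡p (0≤g k)) ⟩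
      g k * ∣ e k ∣      ≤⟨ *-mono-nonNeg {∣ e k ∣} {C} {g k} (0≤g k) h ⟩
      g k * C            ≡⟨ *-comm (g k) C ⟩
      C * g k            ∎
    head : ∀ m → ∣ ∑ m (λ k → g k * e k) ∣ ≤ B * ∑ m g
    head zero    = ≤-reflexive (sym (*-zeroʳ B))
    head (suc m) = begin
      ∣ ∑ m (λ k → g k * e k) + g m * e m ∣      ≤⟨ ∣p+q∣≤∣p∣+∣q∣ (∑ m (λ k → g k * e k)) (g m * e m) ⟩
      ∣ ∑ m (λ k → g k * e k) ∣ + ∣ g m * e m ∣  ≤⟨ +-mono-≤ (head m) (term m B (e≤B m)) ⟩
      B * ∑ m g + B * g m                        ≡⟨ *-distribˡ-+ B (∑ m g) (g m) ⟨
      B * ∑ (suc m) g                            ∎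
    go : ∀ j → ∣ ∑ (j ℕ.+ N) (λ k → g k * e k) ∣ ≤ B * ∑ N g + ε * ∑ (j ℕ.+ N) g
    go zero    = ≤-trans (head N) (p≤p+q {B * ∑ N g} {ε * ∑ N g} (0≤* {ε} {∑ N g} 0≤ε (∑-nonneg N 0≤g)))
    go (suc j) = begin
      ∣ ∑ m (λ k → g k * e k) + g m * e m ∣      ≤⟨ ∣p+q∣≤∣p∣+∣q∣ (∑ m (λ k → g k * e k)) (g m * e m) ⟩
      ∣ ∑ m (λ k → g k * e k) ∣ + ∣ g m * e m ∣  ≤⟨ +-mono-≤ (go j) (term m ε (e≤ε m (ℕ.m≤n+m N j))) ⟩
      B * ∑ N g + ε * ∑ m g + ε * g m            ≡⟨ solve 4 (λ a e s x → a :+ e :* s :+ e :* x := a :+ e :* (s :+ x)) refl (B * ∑ N g) ε (∑ m g) (g m) ⟩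
      B * ∑ N g + ε * ∑ (suc m) g                ∎
      where m = j ℕ.+ N

  -- Null sequences and bounded sequences

  Null : (ℕ → ℚ) → Set
  Null f = ∀ ε → 0ℚ < ε → ∃ λ N → ∀ n → N ℕ.≤ n → ∣ f n ∣ < ε

  shrink : ∀ C → 0ℚ ≤ C → ∀ ε → 0ℚ < ε → ∃ λ δ → 0ℚ < δ × C * δ < ε
  shrink C 0≤C ε 0<ε = δ , 0<δ , (begin-strict
    C * δ                    ≡⟨ +-identityˡ (C * δ) ⟨
    0ℚ + C * δ               <⟨ +-monoˡ-< (C * δ) 0<δ ⟩
    δ + C * δ                ≡⟨ solve 3 (λ e c i → e :* i :+ c :* (e :* i) := e :* ((con 1ℚ :+ c) :* i)) refl ε C i ⟩
    ε * ((1ℚ + C) * i)       ≡⟨ cong (ε *_) (*-recip (1ℚ + C) 0<1+C) ⟩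
    ε * 1ℚ                   ≡⟨ *-identityʳ ε ⟩
    ε                        ∎)
    where
    open ≤-Reasoning
    0<1+C : 0ℚ < 1ℚ + C
    0<1+C = 0<+ (positive⁻¹ 1ℚ) 0≤C
    i = recip (1ℚ + C) 0<1+C
    δ = ε * i
    0<δ : 0ℚ < δ
    0<δ = 0<* 0<ε (0<recip (1ℚ + C) 0<1+C)

  null-scale : ∀ {f} C → 0ℚ ≤ C → (∀ ε → 0ℚ < ε → ∃ λ N → ∀ n → N ℕ.≤ n → ∣ f n ∣ ≤ C * ε) → Null f
  null-scale C 0≤C h ε 0<ε =
    let δ , 0<δ , Cδ<ε = shrink C 0≤C ε 0<ε
        N , bound = h δ 0<δ
    in N , λ n N≤n → ≤-<-trans (bound n N≤n) Cδ<ε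

  null-cong : ∀ {f g : ℕ → ℚ} → (∀ n → f n ≡ g n) → Null f → Null g
  null-cong f≗g h ε 0<ε = let N , b = h ε 0<ε in N , λ n N≤n → subst (λ x → ∣ x ∣ < ε) (f≗g n) (b n N≤n)

  null-+ : ∀ (f g : ℕ → ℚ) → Null f → Null g → Null (λ n → f n + g n)
  null-+ f g hf hg = null-scale 2ℚ (*≤* (+≤+ z≤n)) λ ε 0<ε →
    let M , p = hf ε 0<ε
        N , q = hg ε 0<ε
    in M ℕ.⊔ N , λ n h → let M≤n , N≤n = both {M} h in begin
      ∣ f n + g n ∣        ≤⟨ ∣p+q∣≤∣p∣+∣q∣ (f n) (g n) ⟩
      ∣ f n ∣ + ∣ g n ∣    ≤⟨ +-mono-≤ (<⇒≤ (p n M≤n)) (<⇒≤ (q n N≤n)) ⟩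
      ε + ε                ≡⟨ solve 1 (λ e → e :+ e := con 2ℚ :* e) refl ε ⟩
      2ℚ * ε               ∎
    where open ≤-Reasoning

  Bounded : (ℕ → ℚ) → Set
  Bounded f = ∃ λ K → 0ℚ ≤ K × (∀ n → ∣ f n ∣ ≤ K)

  null-* : ∀ (b f : ℕ → ℚ) → Bounded b → Null f → Null (λ n → b n * f n)
  null-* b f (K , 0≤K , b≤K) hf = null-scale K 0≤K λ ε 0<ε →
    let N , p = hf ε 0<ε
    in N , λ n N≤n → begin
      ∣ b n * f n ∣      ≡⟨ ∣p*q∣≡∣p∣*∣q∣ (b n) (f n) ⟩
      ∣ b n ∣ * ∣ f n ∣  ≤⟨ *-mono₂ (0≤∣p∣ (b n)) (<⇒≤ 0<ε) (b≤K n) (<⇒≤ (p n N≤n)) ⟩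
      K * ε              ∎
    where open ≤-Reasoning

  bounded-prefix : ∀ (f : ℕ → ℚ) N → ∃ λ K → 0ℚ ≤ K × (∀ n → n ℕ.< N → ∣ f n ∣ ≤ K)
  bounded-prefix f zero    = 0ℚ , ≤-refl , λ _ ()
  bounded-prefix f (suc N) = extend (bounded-prefix f N)
    where
    extend : (∃ λ K → 0ℚ ≤ K × (∀ n → n ℕ.< N → ∣ f n ∣ ≤ K)) → ∃ λ K → 0ℚ ≤ K × (∀ n → n ℕ.< suc N → ∣ f n ∣ ≤ K)
    extend (K , 0≤K , h) = K + ∣ f N ∣ , 0≤+ 0≤K (0≤∣p∣ (f N)) , λ n n<1+N →
      Sum.[ (λ n<N → ≤-trans (h n n<N) (p≤p+q (0≤∣p∣ (f N))))
          , (λ { refl → subst (_≤ K + ∣ f n ∣) (+-identityˡ ∣ f n ∣) (+-monoˡ-≤ ∣ f n ∣ 0≤K) })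
          ]′ (ℕ.m≤n⇒m<n∨m≡n (ℕ.≤-pred n<1+N))

  bounded : ∀ x → Bounded (seq x)
  bounded x =
    let K , 0≤K , N , tail = eventual-bound x
        L , 0≤L , front = bounded-prefix (seq x) N
    in K + L , 0≤+ 0≤K 0≤L , λ n →
      Sum.[ (λ n<N → ≤-trans (front n n<N) (subst (_≤ K + L) (+-identityˡ L) (+-monoˡ-≤ L 0≤K)))
          , (λ N≤n → ≤-trans (tail n N≤n) (p≤p+q 0≤L))
          ]′ (ℕ.<-≤-connex n N)

  -- The gaps are nonnegative, have bounded sum, and tend to 0 for each fixed k (Toeplitz's theorem).
  toeplitz : ∀ (x : ℝ) → seq x 0 ≡ 0ℚ →
    Null (λ n → ∑ (suc n) (λ k → coeff n k * Δ (seq x) k) - wallis n * seq x (suc n))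
  toeplitz x x0 = null-cong rewrite-gap (null-scale (B + 2ℚ) (0≤+ {B} {2ℚ} 0≤B (*≤* (+≤+ z≤n))) bound)
    where
    open ≤-Reasoning
    K = proj₁ (bounded x)
    0≤K = proj₁ (proj₂ (bounded x))
    ∣x∣≤K = proj₂ (proj₂ (bounded x))
    B = K + K
    0≤B : 0ℚ ≤ B
    0≤B = 0≤+ 0≤K 0≤K
    -- The value at n+1 stands in for the limit of x, which need not be rational.
    err : ℕ → ℕ → ℚ
    err n k = seq x (suc k) - seq x (suc n)
    rewrite-gap : ∀ n → ∑ (suc n) (λ k → gap n k * err n k)
      ≡ ∑ (suc n) (λ k → coeff n k * Δ (seq x) k) - wallis n * seq x (suc n)
    rewrite-gap n = sym (trans (cong (_- wallis n * seq x (suc n)) (abel-gap n (seq x) (seq x (suc n)) x0))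
      (cancel (∑ (suc n) (λ k → gap n k * err n k)) (wallis n * seq x (suc n))))
      where
      cancel : ∀ a b → (a + b) - b ≡ a
      cancel = solve 2 (λ a b → (a :+ b) :- b := a) refl
    err≤B : ∀ n k → ∣ err n k ∣ ≤ B
    err≤B n k = ≤-trans (∣p+q∣≤∣p∣+∣q∣ (seq x (suc k)) (- seq x (suc n)))
      (+-mono-≤ (∣x∣≤K (suc k)) (subst (_≤ K) (sym (∣-p∣≡∣p∣ (seq x (suc n)))) (∣x∣≤K (suc n))))
    bound : ∀ ε → 0ℚ < ε → ∃ λ N → ∀ n → N ℕ.≤ n → ∣ ∑ (suc n) (λ k → gap n k * err n k) ∣ ≤ (B + 2ℚ) * ε
    bound ε 0<ε = N ℕ.⊔ M , λ n h → estimate n (proj₁ (both {N} h)) (proj₂ (both {N} h))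
      where
      N = proj₁ (cauchy x ε 0<ε)
      -- By `gap≤` the first N gaps of row n add up to at most C times `odd⁻¹ n`; `M` is chosen to
      -- bring this below ε.
      C = ∑ N (λ k → 4ℚ * odd (suc k))
      0≤C : 0ℚ ≤ C
      0≤C = ∑-nonneg N λ k → 0≤* {4ℚ} {odd (suc k)} (*≤* (+≤+ z≤n)) (0≤odd (suc k))
      δ = proj₁ (shrink C 0≤C ε 0<ε)
      0<δ = proj₁ (proj₂ (shrink C 0≤C ε 0<ε))
      Cδ<ε = proj₂ (proj₂ (shrink C 0≤C ε 0<ε))
      M = proj₁ (odd⁻¹→0 δ 0<δ)
      front : ∀ n → M ℕ.≤ n → ∑ N (gap n) ≤ ε
      front n M≤n = begin
        ∑ N (gap n)                                 ≤⟨ ∑-mono N (gap≤ n) ⟩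
        ∑ N (λ k → odd⁻¹ n * (4ℚ * odd (suc k)))    ≡⟨ ∑-* N (odd⁻¹ n) (λ k → 4ℚ * odd (suc k)) ⟩
        odd⁻¹ n * C                                 ≡⟨ *-comm (odd⁻¹ n) C ⟩
        C * odd⁻¹ n                                 ≤⟨ *-mono-nonNeg {odd⁻¹ n} {δ} {C} 0≤C (<⇒≤ (proj₂ (odd⁻¹→0 δ 0<δ) n M≤n)) ⟩
        C * δ                                       <⟨ Cδ<ε ⟩
        ε                                           ∎
      estimate : ∀ n → N ℕ.≤ n → M ℕ.≤ n → ∣ ∑ (suc n) (λ k → gap n k * err n k) ∣ ≤ (B + 2ℚ) * ε
      estimate n N≤n M≤n = begin
        ∣ ∑ (suc n) (λ k → gap n k * err n k) ∣
          ≤⟨ subst (λ m → ∣ ∑ m (λ k → gap n k * err n k) ∣ ≤ B * ∑ N (gap n) + ε * ∑ m (gap n))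
               (ℕ.m∸n+n≡m (ℕ.m≤n⇒m≤1+n N≤n))
               (∣∑∣≤ (gap n) (err n) N B ε (0≤gap n) (<⇒≤ 0<ε) (err≤B n)
                 (λ k N≤k → <⇒≤ (proj₂ (cauchy x ε 0<ε) (suc k) (suc n) (ℕ.m≤n⇒m≤1+n N≤k) (ℕ.m≤n⇒m≤1+n N≤n)))
                 (suc n ℕ.∸ N)) ⟩
        B * ∑ N (gap n) + ε * ∑ (suc n) (gap n)
          ≤⟨ +-mono-≤ {B * ∑ N (gap n)} {B * ε} {ε * ∑ (suc n) (gap n)} {ε * 2ℚ}
               (*-mono-nonNeg {∑ N (gap n)} {ε} {B} 0≤B (front n M≤n))
               (*-mono-nonNeg {∑ (suc n) (gap n)} {2ℚ} {ε} (<⇒≤ 0<ε)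
                 (≤-trans {∑ (suc n) (gap n)} {wallis n} {2ℚ} (∑-gap≤wallis n (suc n)) (wallis≤2 n))) ⟩
        B * ε + ε * 2ℚ
          ≡⟨ solve 2 (λ b e → b :* e :+ e :* con 2ℚ := (b :+ con 2ℚ) :* e) refl B ε ⟩
        (B + 2ℚ) * ε ∎

  -- The factor 4/π in the limit

  *-inv : ∀ x (p : Positiveᵣ x) n → seq x (proj₁ (proj₂ (proj₂ p)) ℕ.+ n) * seq (inv x p) n ≡ 1ℚ
  *-inv x (δ , 0<δ , N , δ≤x) n = *-recip (seq x (N ℕ.+ n)) (<-≤-trans 0<δ (δ≤x (N ℕ.+ n) (ℕ.m≤m+n N n)))

  -- `π-positive` holds from index 1 on and `inv` drops the entries before it, hence the shift by
  -- one.
  4/π*leibniz : ∀ n → seq (4 /π) n * leibnizSum (suc n) ≡ 1ℚ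
  4/π*leibniz n = trans
    (solve 2 (λ v l → con 4ℚ :* v :* l := con 4ℚ :* l :* v) refl (seq (inv π π-positive) n) (leibnizSum (suc n)))
    (*-inv π π-positive n)

  -- By `toeplitz` for H, the entry of x at n+1 is `wallis n` times that of H up to a null sequence.
  -- By `toeplitz` for Leibniz's sums, where the expansion equals 1, `wallis n` differs from the
  -- entries of 4/π by a null sequence.
  ≃-4/π* : ∀ (x H : ℝ) → seq H 0 ≡ 0ℚ →
    (∀ n → seq x (suc n) ≡ ∑ (suc n) (λ k → coeff n k * Δ (seq H) k)) → x ≃ (4 /π) *ᵣ H
  ≃-4/π* x H H0 expand ε 0<ε = suc N , λ { (suc n) (s≤s N≤n) → small n N≤n }
    where
    v d₁ d₂ ℓ : ℕ → ℚ
    v n = seq (4 /π) (suc n)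
    d₁ n = ∑ (suc n) (λ k → coeff n k * Δ (seq H) k) - wallis n * seq H (suc n)
    d₂ n = ∑ (suc n) (λ k → coeff n k * Δ leibnizSum k) - wallis n * leibnizSum (suc n)
    -- `v n` is inverse to the Leibniz sum at n+2, whereas `d₂` contains the one at n+1; `ℓ` bridges
    -- the two.
    ℓ n = leibnizSum (suc (suc n)) - leibnizSum (suc n)
    shifted : ∀ {f : ℕ → ℚ} → Bounded f → Bounded (λ n → f (suc n))
    shifted (K , 0≤K , h) = K , 0≤K , λ n → h (suc n)
    wallis-bounded : Bounded wallis
    wallis-bounded = 2ℚ , *≤* (+≤+ z≤n) , λ n → subst (_≤ 2ℚ) (sym (0≤p⇒∣p∣≡p (0≤wallis n))) (wallis≤2 n)
    ℓ-null : Null ℓ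
    ℓ-null ε 0<ε = proj₁ (cauchy leibniz ε 0<ε) , λ n N≤n →
      proj₂ (cauchy leibniz ε 0<ε) (suc (suc n)) (suc n) (ℕ.m≤n⇒m≤1+n (ℕ.m≤n⇒m≤1+n N≤n)) (ℕ.m≤n⇒m≤1+n N≤n)
    -- This equals `wallis n - v n`, since `v n` times the Leibniz sum at n+2 is 1.
    coefficient : ℕ → ℚ
    coefficient n = v n * (- 1ℚ * d₂ n + wallis n * ℓ n)
    coefficient-null : Null coefficient
    coefficient-null = null-* v (λ n → - 1ℚ * d₂ n + wallis n * ℓ n) (shifted (bounded (4 /π)))
      (null-+ (λ n → - 1ℚ * d₂ n) (λ n → wallis n * ℓ n)
        (null-* (λ _ → - 1ℚ) d₂ (1ℚ , *≤* (+≤+ z≤n) , λ _ → ≤-refl) (toeplitz leibniz refl))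
        (null-* wallis ℓ wallis-bounded ℓ-null))
    total-null : Null (λ n → d₁ n + seq H (suc n) * coefficient n)
    total-null = null-+ d₁ (λ n → seq H (suc n) * coefficient n) (toeplitz H H0)
      (null-* (λ n → seq H (suc n)) coefficient (shifted (bounded H)) coefficient-null)
    rearrange : ∀ X L x w h v l l′ → X ≡ x → L ≡ 1ℚ → v * l′ ≡ 1ℚ →
      (X - w * h) + h * (v * (- 1ℚ * (L - w * l) + w * (l′ - l))) ≡ x - v * h
    rearrange X _ _ w h v l l′ refl refl vl′ = trans
      (solve 6 (λ X w h v l l′ → (X :- w :* h) :+ h :* (v :* (con (- 1ℚ) :* (con 1ℚ :- w :* l) :+ w :* (l′ :- l)))
        := X :- v :* h :+ w :* h :* (v :* l′ :- con 1ℚ)) refl X w h v l l′)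
      (trans (cong (λ z → X - v * h + w * h * (z - 1ℚ)) vl′)
        (solve 4 (λ X w h v → X :- v :* h :+ w :* h :* (con 1ℚ :- con 1ℚ) := X :- v :* h) refl X w h v))
    N = proj₁ (total-null ε 0<ε)
    small : ∀ n → N ℕ.≤ n → ∣ seq x (suc n) - v n * seq H (suc n) ∣ < ε
    small n N≤n = subst (λ z → ∣ z ∣ < ε)
      (rearrange (∑ (suc n) (λ k → coeff n k * Δ (seq H) k)) (∑ (suc n) (λ k → coeff n k * Δ leibnizSum k))
        (seq x (suc n)) (wallis n) (seq H (suc n)) (v n) (leibnizSum (suc n)) (leibnizSum (suc (suc n)))
        (sym (expand n)) (leibniz-expansion n) (4/π*leibniz (suc n)))
      (proj₂ (total-null ε 0<ε) n N≤n)

  ≃-resp-seq : ∀ x y z → (∀ n → seq y n ≡ seq z n) → x ≃ y → x ≃ z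
  ≃-resp-seq x y z y≗z = null-cong λ n → cong (λ a → seq x n - a) (y≗z n)

  seq-t⋆ : ∀ ss (adm : Admissible ss) n → seq (t⋆ ss adm) n ≡ t⋆Sum n ss
  seq-t⋆ (s ∷ ss) (admissible _ _) n = refl

  -- The factor 4/π is distributed over H entry by entry, which is a ring identity in the entry of
  -- the reciprocal of π. Matching on the letter lists and their admissibility lets each `t` compute
  -- to its truncations.
  t⋆-evaluation : ∀ {ss u v w z} adm adm-u adm-v adm-w adm-z → Expands ss (Δ (fourTerms u v w z)) →
    t⋆ ss adm ≃ -ᵣ (4 /π) *ᵣ t u adm-u -ᵣ (8 /π) *ᵣ t v adm-v -ᵣ (8 /π) *ᵣ t w adm-w -ᵣ (16 /π) *ᵣ t z adm-z
  t⋆-evaluation {ss} {u@(_ ∷ _)} {v@(_ ∷ _)} {w@(_ ∷ _)} {z@(_ ∷ _)} adm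
    adm-u@(admissible _ _) adm-v@(admissible _ _) adm-w@(admissible _ _) adm-z@(admissible _ _) e =
    ≃-resp-seq (t⋆ ss adm) ((4 /π) *ᵣ H) RHS (λ n → distribute (seq (inv π π-positive) n) (tSum n u) (tSum n v) (tSum n w) (tSum n z))
      (≃-4/π* (t⋆ ss adm) H refl λ n → trans (seq-t⋆ ss adm (suc n)) (expansion e n))
    where
    H = -ᵣ t u adm-u -ᵣ real 2ℚ *ᵣ t v adm-v -ᵣ real 2ℚ *ᵣ t w adm-w -ᵣ real 4ℚ *ᵣ t z adm-z
    RHS = -ᵣ (4 /π) *ᵣ t u adm-u -ᵣ (8 /π) *ᵣ t v adm-v -ᵣ (8 /π) *ᵣ t w adm-w -ᵣ (16 /π) *ᵣ t z adm-z
    distribute : ∀ i a b c d → 4ℚ * i * (- a - 2ℚ * b - 2ℚ * c - 4ℚ * d)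
      ≡ - (4ℚ * i) * a - (+ 8 / 1) * i * b - (+ 8 / 1) * i * c - (+ 16 / 1) * i * d
    distribute = solve 5 (λ i a b c d → con 4ℚ :* i :* (:- a :- con 2ℚ :* b :- con 2ℚ :* c :- con 4ℚ :* d)
      := :- (con 4ℚ :* i) :* a :- con (+ 8 / 1) :* i :* b :- con (+ 8 / 1) :* i :* c :- con (+ 16 / 1) :* i :* d) refl

-- The two evaluations

open import Data.List using ([]; _∷_; _++_)
open import Data.List.Relation.Unary.All using ([]; _∷_)
open import Data.Nat using (ℕ; _+_; _*_; _≤_; z≤n; s≤s)
open import Data.Product using (_×_; _,_)
open import Defs
open Truncations using (t⋆-evaluation; expands-1-3; expands-1-1)

theorem4p6 : (a b c : ℕ) (1≤a : 1 ≤ a) →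
    ( t⋆ (twos a ++ 1 ∷ twos b ++ 3 ∷ twos c) (t⋆-adm b c 1≤a (s≤s z≤n))
    ≃ -ᵣ (4 /π) *ᵣ t (bar (2 * a + 2 * b + 2 * c + 5) ∷ [])
    (admissible (1<m+2+k (2 * a + 2 * b + 2 * c)) [])
    -ᵣ (8 /π) *ᵣ t (plain (2 * a + 1) ∷ bar (2 * b + 2 * c + 4) ∷ [])
    (admissible (1<2a+1 1≤a) (1≤m+1+k (2 * b + 2 * c) ∷ []))
    -ᵣ (8 /π) *ᵣ t (bar (2 * a + 2 * b + 3) ∷ plain (2 * c + 2) ∷ [])
    (admissible (1<m+2+k (2 * a + 2 * b)) (1≤m+1+k (2 * c) ∷ []))
    -ᵣ (16 /π) *ᵣ t (plain (2 * a + 1) ∷ bar (2 * b + 2) ∷ plain (2 * c + 2) ∷ [])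
    (admissible (1<2a+1 1≤a) (1≤m+1+k (2 * b) ∷ 1≤m+1+k (2 * c) ∷ [])) )
    ×
    ( t⋆ (twos a ++ 1 ∷ twos b ++ 1 ∷ twos c) (t⋆-adm b c 1≤a (s≤s z≤n))
    ≃ -ᵣ (4 /π) *ᵣ t (bar (2 * a + 2 * b + 2 * c + 3) ∷ [])
    (admissible (1<m+2+k (2 * a + 2 * b + 2 * c)) [])
    -ᵣ (8 /π) *ᵣ t (plain (2 * a + 1) ∷ bar (2 * b + 2 * c + 2) ∷ [])
    (admissible (1<2a+1 1≤a) (1≤m+1+k (2 * b + 2 * c) ∷ []))
    -ᵣ (8 /π) *ᵣ t (plain (2 * a + 2 * b + 2) ∷ bar (2 * c + 1) ∷ [])
    (admissible (1<m+2+k (2 * a + 2 * b)) (1≤m+1+k (2 * c) ∷ []))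
    -ᵣ (16 /π) *ᵣ t (plain (2 * a + 1) ∷ plain (2 * b + 1) ∷ bar (2 * c + 1) ∷ [])
    (admissible (1<2a+1 1≤a) (1≤m+1+k (2 * b) ∷ 1≤m+1+k (2 * c) ∷ [])) )
theorem4p6 a b c 1≤a =
  t⋆-evaluation (t⋆-adm b c 1≤a (s≤s z≤n))
    (admissible (1<m+2+k (2 * a + 2 * b + 2 * c)) [])
    (admissible (1<2a+1 1≤a) (1≤m+1+k (2 * b + 2 * c) ∷ []))
    (admissible (1<m+2+k (2 * a + 2 * b)) (1≤m+1+k (2 * c) ∷ []))
    (admissible (1<2a+1 1≤a) (1≤m+1+k (2 * b) ∷ 1≤m+1+k (2 * c) ∷ []))
    (expands-1-3 a b c) ,
  t⋆-evaluation (t⋆-adm b c 1≤a (s≤s z≤n))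
    (admissible (1<m+2+k (2 * a + 2 * b + 2 * c)) [])
    (admissible (1<2a+1 1≤a) (1≤m+1+k (2 * b + 2 * c) ∷ []))
    (admissible (1<m+2+k (2 * a + 2 * b)) (1≤m+1+k (2 * c) ∷ []))
    (admissible (1<2a+1 1≤a) (1≤m+1+k (2 * b) ∷ 1≤m+1+k (2 * c) ∷ []))
    (expands-1-1 a b c)
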